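{- Let $(p,l)\in\Psi_1^{\rm irr}$ with $\Delta_{(p,l)}\neq0$. The $p$-adic zeta function $\zeta_{p,l}:\mathbb{Z}_p\to\mathbb{Z}_p$ has a unique zero, at $s=\chi_{(p,l)}$.
   Context: $B_n$ denotes the Bernoulli numbers, $\frac{z}{e^z-1}=\sum_{n\ge0}B_n\frac{z^n}{n!}$, and $\widehat{B}(n)=B_n/n$; $\varphi$ is Euler's totient function. For rational $q$ and a positive integer $m$, $m\mid q$ means that $m$ divides the numerator of $q$ in lowest terms. For $n\ge1$, $\Psi_n^{\rm irr}$ is the set of pairs $(p,l)$ with $p$ an odd prime, $l$ even, $2\le l<\varphi(p^n)$ and $p^n\mid\widehat{B}(l)$. For $(p,l)\in\Psi_1^{\rm irr}$, $\Delta_{(p,l)}$ is the integer with $0\le\Delta_{(p,l)}<p$ and $\Delta_{(p,l)}\equiv p^{ -1}\left(\widehat{B}(l+p-1)-\widehat{B}(l)\right)\pmod p$. If $(p,l)\in\Psi_1^{\rm irr}$ and $\Delta_{(p,l)}\ne0$, then (known) for each $n\ge1$ there is exactly one $(p,l_n)\in\Psi_n^{\rm irr}$ with $l_n\equiv l\pmod{p-1}$, and there are unique digits $0\le s_\nu<p$ ($\nu\ge2$) with $l_n=l+(p-1)\sum_{\nu=0}^{n-2}s_{\nu+2}p^\nu$ for all $n\ge1$. Define $\chi_{(p,l)}=\sum_{\nu\ge0}s_{\nu+2}\,p^\nu\in\mathbb{Z}_p$. For $n\ge2$ put $\zeta_p(1-n)=(1-p^{n-1})\zeta(1-n)=-(1-p^{n-1})B_n/n$.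 For a prime $p\ge5$ and $s_1\in\{2,4,\ldots,p-3\}$, $\zeta_{p,s_1}:\mathbb{Z}_p\to\mathbb{Z}_p$ is defined by $\zeta_{p,s_1}(s)=\lim_{t_\nu\to s}\zeta_p(1-(s_1+(p-1)t_\nu))$ for any sequence $(t_\nu)$ of nonnegative integers converging $p$-adically to $s$; by the Kummer congruences this is well defined and continuous. -}

module Defs where

open import Level using (0ℓ)
open import Data.Nat.Base as ℕ using (ℕ; zero; suc; _∸_; _^_; _≤_; _<_; _!)
import Data.Nat.Properties as ℕᵖ
import Data.Nat.Divisibility as ℕ∣
open import Data.Nat.Coprimality using (coprime?)
open import Data.Nat.Primality using (Prime)
open import Data.Integer.Base as ℤ using (ℤ; +_; ∣_∣)
import Data.Integer.Properties as ℤᵖ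
import Data.Integer.Divisibility as ℤ∣
open import Data.Rational.Base as ℚ using (ℚ; 0ℚ; 1ℚ; _/_; ↥_; _+_; _*_; _-_; -_)
import Data.Rational.Properties as ℚᵖ
open import Data.List.Base using (length; filter; applyUpTo)
open import Data.Vec.Base using (Vec; []; _∷_; head)
open import Data.Product.Base using (_×_; _,_; ∃)
open import Function.Base using (_∘_)
open import Relation.Unary using (Pred; _∈_)
open import Relation.Binary.PropositionalEquality
  using (_≡_; _≢_; refl; sym; trans; cong; cong₂; subst; module ≡-Reasoning)

fromℤ : ℤ → ℚ
fromℤ z = z / 1

fromℕ : ℕ → ℚ
fromℕ n = fromℤ (+ n)

-- 1/n, with the junk value 1/0 = 0.
recip : ℕ → ℚ
recip zero    = 0ℚ
recip (suc n) = + 1 / suc n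

infix 4 _∣ℚ_

-- ↥ q is the numerator of q in lowest terms.
_∣ℚ_ : ℕ → ℚ → Set
m ∣ℚ q = m ℕ∣.∣ ∣ ↥ q ∣

-- A formal power series over ℚ is its sequence of coefficients.

infixl 7 _⊛_

-- (a ⊛ b) n = a 0 * b n + a 1 * b (n - 1) + ⋯ + a n * b 0
_⊛_ : (ℕ → ℚ) → (ℕ → ℚ) → (ℕ → ℚ)
(a ⊛ b) zero    = a 0 * b 0
(a ⊛ b) (suc n) = a 0 * b (suc n) + ((a ∘ suc) ⊛ b) n

dot : ∀ {n} → (ℕ → ℚ) → Vec ℚ n → ℚ
dot a []       = 0ℚ
dot a (x ∷ xs) = a 0 * x + dot (a ∘ suc) xs

-- The multiplicative inverse b of a series a with a 0 = 1 satisfies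
-- b (n + 1) = - (a 1 * b n + ⋯ + a (n + 1) * b 0); inverses a n collects
-- b n, …, b 0.
inverses : (ℕ → ℚ) → (n : ℕ) → Vec ℚ (suc n)
inverses a zero    = 1ℚ ∷ []
inverses a (suc n) = - dot (a ∘ suc) (inverses a n) ∷ inverses a n

inverse : (ℕ → ℚ) → (ℕ → ℚ)
inverse a n = head (inverses a n)

dot-inverses : ∀ a c n → dot c (inverses a n) ≡ (c ⊛ inverse a) n
dot-inverses a c zero    = ℚᵖ.+-identityʳ (c 0 * 1ℚ)
dot-inverses a c (suc n) =
  cong (_+_ (c 0 * inverse a (suc n))) (dot-inverses a (c ∘ suc) n)

one : ℕ → ℚ
one zero    = 1ℚ
one (suc _) = 0ℚ

⊛-inverse : ∀ a → a 0 ≡ 1ℚ → ∀ n → (a ⊛ inverse a) n ≡ one n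
⊛-inverse a a₀≡1 zero    = trans (ℚᵖ.*-identityʳ (a 0)) a₀≡1
⊛-inverse a a₀≡1 (suc n) = begin
  a 0 * - d + ((a ∘ suc) ⊛ inverse a) n
    ≡⟨ cong₂ (λ x y → x * - d + y) a₀≡1 (sym (dot-inverses a (a ∘ suc) n)) ⟩
  1ℚ * - d + d
    ≡⟨ cong (_+ d) (ℚᵖ.*-identityˡ (- d)) ⟩
  - d + d
    ≡⟨ ℚᵖ.+-inverseˡ d ⟩
  0ℚ ∎
  where
  open ≡-Reasoning
  d = dot (a ∘ suc) (inverses a n)

-- e^z - 1
exp-1 : ℕ → ℚ
exp-1 zero    = 0ℚ
exp-1 (suc n) = recip (suc n !)

-- z / (e^z - 1), the inverse of (e^z - 1) / z
z/[exp-1] : ℕ → ℚ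
z/[exp-1] = inverse (exp-1 ∘ suc)

z : ℕ → ℚ
z zero    = 0ℚ
z (suc n) = one n

exp-1⊛z/[exp-1] : ∀ n → (exp-1 ⊛ z/[exp-1]) n ≡ z n
exp-1⊛z/[exp-1] zero    = refl
exp-1⊛z/[exp-1] (suc n) = begin
  0ℚ * z/[exp-1] (suc n) + ((exp-1 ∘ suc) ⊛ z/[exp-1]) n
    ≡⟨ cong (_+ ((exp-1 ∘ suc) ⊛ z/[exp-1]) n) (ℚᵖ.*-zeroˡ (z/[exp-1] (suc n))) ⟩
  0ℚ + ((exp-1 ∘ suc) ⊛ z/[exp-1]) n
    ≡⟨ ℚᵖ.+-identityˡ _ ⟩
  ((exp-1 ∘ suc) ⊛ z/[exp-1]) n
    ≡⟨ ⊛-inverse (exp-1 ∘ suc) refl n ⟩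
  one n ∎
  where open ≡-Reasoning

B : ℕ → ℚ
B n = fromℕ (n !) * z/[exp-1] n

-- B n / n; only meaningful for n ≥ 1.
B̂ : ℕ → ℚ
B̂ n = B n * recip n

-- ζ(1 - n) = - B n / n, for n ≥ 2
ζ[1-_] : ℕ → ℚ
ζ[1- n ] = - B̂ n

-- ζ[ p ][1- n ] = ζ_p(1 - n), for n ≥ 2
ζ[_][1-_] : ℕ → ℕ → ℚ
ζ[ p ][1- n ] = (1ℚ - fromℕ (p ^ (n ∸ 1))) * ζ[1- n ]

φ : ℕ → ℕ
φ n = length (filter (λ k → coprime? k n) (applyUpTo suc n))

record IrregularPair (n p l : ℕ) : Set where
  field
    prime : Prime p
    odd   : p ≢ 2
    even  : 2 ℕ∣.∣ l
    2≤l   : 2 ≤ l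
    l<φ   : l < φ (p ^ n)
    p^n∣B̂ : p ^ n ∣ℚ B̂ l

Ψ-irr : ℕ → Pred (ℕ × ℕ) 0ℓ
Ψ-irr n (p , l) = IrregularPair n p l

-- A congruence modulo m between rationals means that m divides the
-- difference.
record IsΔ (p l Δ : ℕ) : Set where
  field
    Δ<p : Δ < p
    Δ≡  : p ∣ℚ fromℕ Δ - recip p * (B̂ (l ℕ.+ p ∸ 1) - B̂ l)

-- The p-adic integers are the inverse limit of ℤ / p ^ n.

record ℤₚ (p : ℕ) : Set where
  field
    approx   : ℕ → ℤ
    coherent : ∀ n → + (p ^ n) ℤ∣.∣ approx (suc n) ℤ.- approx n

open ℤₚ public

infix 4 _≈_ _⟶_

_≈_ : {p : ℕ} → ℤₚ p → ℤₚ p → Set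
_≈_ {p} x y = ∀ n → + (p ^ n) ℤ∣.∣ approx x n ℤ.- approx y n

0ₚ : {p : ℕ} → ℤₚ p
0ₚ .approx   _ = + 0
0ₚ .coherent _ = ℕ∣.divides 0 refl

-- p-adic convergence of a sequence of rationals to a p-adic integer.
_⟶_ : {p : ℕ} → (ℕ → ℚ) → ℤₚ p → Set
_⟶_ {p} q x =
  ∀ n → ∃ λ N → ∀ ν → N ≤ ν → p ^ n ∣ℚ q ν - fromℤ (approx x n)

-- ∑[ f , n ] = f 0 + ⋯ + f (n - 1)
∑[_,_] : (ℕ → ℕ) → ℕ → ℕ
∑[ f , zero  ] = 0
∑[ f , suc n ] = ∑[ f , n ] ℕ.+ f n

-- The p-adic integer ∑ᵥ a ν * p ^ ν.
series : (p : ℕ) → (ℕ → ℕ) → ℤₚ p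
series p a .approx   n = + ∑[ (λ ν → a ν ℕ.* p ^ ν) , n ]
series p a .coherent n = subst (p ^ n ℕ∣.∣_) (cong ∣_∣ (sym diff)) (ℕ∣.n∣m*n (a n))
  where
  S = ∑[ (λ ν → a ν ℕ.* p ^ ν) , n ]
  t = a n ℕ.* p ^ n
  diff : + (S ℕ.+ t) ℤ.- + S ≡ + t
  diff = begin
    + (S ℕ.+ t) ℤ.- + S         ≡⟨ cong (λ x → + x ℤ.- + S) (ℕᵖ.+-comm S t) ⟩
    (+ t ℤ.+ + S) ℤ.- + S       ≡⟨ ℤᵖ.+-assoc (+ t) (+ S) (ℤ.- + S) ⟩
    + t ℤ.+ (+ S ℤ.- + S)       ≡⟨ cong (ℤ._+_ (+ t)) (ℤᵖ.+-inverseʳ (+ S)) ⟩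
    + t ℤ.+ + 0                 ≡⟨ ℤᵖ.+-identityʳ (+ t) ⟩
    + t                         ∎
    where open ≡-Reasoning

-- l-of n is the order of the n-th irregular pair above (p , l), for n ≥ 1,
-- and s ν, for ν ≥ 2, are its digits; the values l-of 0, s 0 and s 1 are
-- irrelevant.
record Lift (p l : ℕ) : Set where
  field
    l-of   : ℕ → ℕ
    l-of∈Ψ : ∀ n → 1 ≤ n → (p , l-of n) ∈ Ψ-irr n
    l-of≡l : ∀ n → 1 ≤ n → + (p ∸ 1) ℤ∣.∣ + l-of n ℤ.- + l
    s      : ℕ → ℕ
    s<p    : ∀ ν → 2 ≤ ν → s ν < p
    digits : ∀ n → 1 ≤ n →
             l-of n ≡ l ℕ.+ (p ∸ 1) ℕ.* ∑[ (λ ν → s (ν ℕ.+ 2) ℕ.* p ^ ν) , n ∸ 1 ]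

χ : {p l : ℕ} → Lift p l → ℤₚ p
χ {p} L = series p (λ ν → Lift.s L (ν ℕ.+ 2))

-- f = ζ_{p,s₁}. As p-adic limits are unique, this determines f up to _≈_
-- and forces f to respect _≈_.
IsPadicZeta : (p s₁ : ℕ) → (ℤₚ p → ℤₚ p) → Set
IsPadicZeta p s₁ f =
  ∀ (s : ℤₚ p) (t : ℕ → ℕ) → (fromℕ ∘ t) ⟶ s →
  (λ ν → ζ[ p ][1- s₁ ℕ.+ (p ∸ 1) ℕ.* t ν ]) ⟶ f s

{-# OPTIONS --safe #-}

-- Choose c prime to p with c ^ l ≢ 1 mod p. The generating function of
-- (c ^ (k + 1) - 1) B̂ (k + 1) is a quotient of polynomials in e ^ z whose
-- denominator is c at z = 0, so for k < N these numbers, times c ^ N, are moments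
-- ∑ wⱼ j ^ k with integers wⱼ. As u ^ d ≡ 1 + d (u - 1) mod p² d for
-- u = j ^ (p - 1) ≡ 1 mod p, the moment M t at k = l - 1 + (p - 1) t satisfies
-- M (t + d) - M t ≡ d (M 1 - M 0) mod p² d for large t, and Δ ≢ 0 says that
-- p² ∤ M 1 - M 0. Hence p ^ (n + 1) dividing B̂ at both t and t' forces
-- t ≡ t' mod p ^ n, and any two zeros agree. That χ is a zero is immediate from
-- p ^ n ∣ B̂ (l_n).

module Submission where

open import Defs
open import Level using (0ℓ)
open import Data.Nat.Base as ℕ using (ℕ; zero; suc; _!; _∸_; _≤_; _<_; s≤s; z≤n)
import Data.Nat.Properties as ℕᵖ
import Data.Nat.Divisibility as ℕ∣
open import Data.Nat.Coprimality as Coprimality using (coprime?)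
open import Data.Nat.Primality using (Prime; euclidsLemma; prime⇒nonZero; prime⇒nonTrivial)
open import Data.Integer.Base as ℤ using (ℤ; +_; 0ℤ; 1ℤ)
import Data.Integer.Properties as ℤᵖ
import Data.Integer.DivMod as ℤ/
open import Data.Integer.Divisibility.Signed
import Data.Integer.Tactic.RingSolver as ℤ-Solver
open import Data.Rational.Base using (ℚ; 0ℚ; 1ℚ; ↥_; ↧_; toℚᵘ)
import Data.Rational.Properties as ℚᵖ
open import Data.Rational.Unnormalised.Base as ℚᵘ using (mkℚᵘ; *≡*)
import Data.Rational.Unnormalised.Properties as ℚᵘᵖ
open import Data.List.Base using (List; []; _∷_; _++_; map; applyUpTo)
open import Data.List.Properties using (filter-notAll; length-applyUpTo)
open import Data.List.Membership.Propositional using (lose)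
open import Data.List.Membership.Propositional.Properties using (∈-applyUpTo⁺)
open import Data.Product.Base using (_×_; _,_; ∃-syntax; proj₁; proj₂)
open import Data.Sum.Base using (_⊎_; inj₁; inj₂; [_,_]′)
open import Function.Base using (_∘_)
open import Relation.Binary.PropositionalEquality
open import Relation.Nullary using (¬_; yes; no; contradiction; ¬?; _×-dec_)
open import Relation.Nullary.Decidable using (dec⇒maybe; decidable-stable)
open import Relation.Unary using (_∈_)
open import Tactic.RingSolver using (solve-∀)
open import Tactic.RingSolver.Core.AlmostCommutativeRing using (AlmostCommutativeRing; fromCommutativeRing)

-- Moments of integer weights modulo powers of p

-- In the quotient G = c / (e^(cz) - 1) - 1 / (e^z - 1) the denominator e^(cz) - 1 vanishes at z =
-- 0, so it cannot be inverted as it stands. But (e^(cz) - 1) G = c - (1 + e^z + ... + e^((c-1)z)),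
-- and both sides contain a factor e^z - 1. Cancelling it leaves 1 + e^z + ... + e^((c-1)z) as the
-- denominator, with value c at 0; inverting that costs one factor c per degree, whence c ^ N. A
-- sequence stands for its exponential generating function, and multiplication by e^(yz) and by z
-- become the recursive operators `S y` and `D`, so that no binomial coefficients appear. The factor
-- c ^ k - 1 has to be prime to p only where Δ is compared with M 1 - M 0; elsewhere divisibility
-- passes from `B̂` to the moments by mere multiplication. Nodes j divisible by p have no u ≡ 1;
-- their powers must vanish modulo p^(k+2) on their own, which forces the lower bounds on t and on l
-- - 1.

module _ where

  open import Data.Integer.Base using (_+_; _*_; _-_; -_; _^_)

  moment : List (ℤ × ℕ) → ℕ → ℤ
  moment []             k = 0ℤ
  moment ((w , x) ∷ ws) k = w * + (x ℕ.^ k) + moment ws k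

  pos-^ : ∀ x n → + (x ℕ.^ n) ≡ (+ x) ^ n
  pos-^ x zero    = refl
  pos-^ x (suc n) = trans (ℤᵖ.pos-* x (x ℕ.^ n)) (cong (+ x *_) (pos-^ x n))

  -- The binomial coefficient n choose 2, by recursion to avoid a division by 2.
  triangle : ℕ → ℤ
  triangle zero    = 0ℤ
  triangle (suc n) = triangle n + + n

  triangle-double : ∀ n → + suc n * + n ≡ + 2 * triangle (suc n)
  triangle-double zero    = refl
  triangle-double (suc n) = trans (expand (+ n))
    (trans (cong (_+ + 2 * (1ℤ + + n)) (triangle-double n)) (sym (ℤᵖ.*-distribˡ-+ (+ 2) (triangle (suc n)) (+ suc n))))
    where
    expand : ∀ n → (1ℤ + (1ℤ + n)) * (1ℤ + n) ≡ (1ℤ + n) * n + + 2 * (1ℤ + n)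
    expand = ℤ-Solver.solve-∀

  -- The quadratic coefficient is kept explicit because its divisibility by p is needed when n = p;
  -- cubic terms are always small enough, so an unspecified r suffices.
  [1+z]^n : ∀ z n → ∃[ r ] (1ℤ + z) ^ n ≡ 1ℤ + + n * z + triangle n * (z * z) + r * (z * z * z)
  [1+z]^n z zero    = 0ℤ , expand z
    where
    expand : ∀ z → 1ℤ ≡ 1ℤ + 0ℤ * z + 0ℤ * (z * z) + 0ℤ * (z * z * z)
    expand = ℤ-Solver.solve-∀
  [1+z]^n z (suc n) with [1+z]^n z n
  ... | r , eq = r + triangle n + r * z , trans (cong ((1ℤ + z) *_) eq) (expand z (+ n) (triangle n) r)
    where
    expand : ∀ z n t r → (1ℤ + z) * (1ℤ + n * z + t * (z * z) + r * (z * z * z))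
      ≡ 1ℤ + (1ℤ + n) * z + (t + n) * (z * z) + (r + t + r * z) * (z * z * z)
    expand = ℤ-Solver.solve-∀

  ∣⇒^∣^ : ∀ {i x m n} → i ∣ x → m ≤ n → i ^ m ∣ x ^ n
  ∣⇒^∣^ {x = x} {n = n}   i∣x z≤n       = divides (x ^ n) (sym (ℤᵖ.*-identityʳ (x ^ n)))
  ∣⇒^∣^ {i} {x} {suc m} {suc n} i∣x (s≤s m≤n) =
    ∣-trans (*-monoˡ-∣ (i ^ m) i∣x) (*-monoʳ-∣ x (∣⇒^∣^ i∣x m≤n))

  p²P∣εPx : ∀ p P ε {x} → p ^ 2 ∣ x → p * (p * P) ∣ ε * P * x
  p²P∣εPx p P ε (divides q refl) = divides (ε * q) (swap p P ε q)
    where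
    swap : ∀ p P ε q → ε * P * (q * (p * (p * 1ℤ))) ≡ ε * q * (p * (p * P))
    swap = ℤ-Solver.solve-∀

  p²∣εx : ∀ p P ε {x} .{{_ : ℤ.NonZero P}} → p * (p * P) ∣ ε * P * x → p ^ 2 ∣ ε * x
  p²∣εx p P ε {x} div = *-cancelˡ-∣ P (subst₂ _∣_ (swap p P) (swap′ ε P x) div)
    where
    swap : ∀ p P → p * (p * P) ≡ P * (p * (p * 1ℤ))
    swap = ℤ-Solver.solve-∀
    swap′ : ∀ ε P x → ε * P * x ≡ P * (ε * x)
    swap′ = ℤ-Solver.solve-∀

  ∣-cancel : ∀ {i a b} → i ∣ a → i ∣ a - b → i ∣ b
  ∣-cancel {i} {a} {b} i∣a i∣a-b = subst (i ∣_) (cancel a b) (∣m∣n⇒∣m-n i∣a i∣a-b)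
    where
    cancel : ∀ a b → a - (a - b) ≡ b
    cancel = ℤ-Solver.solve-∀

  -- Here w = x ^ e, u = 1 + p a, u ^ t = 1 + p b, and the last factor of x₁ is u ^ d for d = P ε.
  -- The terms of order p P cancel. The stray factor 1ℤ is p ^ 0, left by expanding u ^ t with k =
  -- 0.
  unit-congruence : ∀ p P ε w a y b {x₁ x₀ y₁ y₀} →
    x₁ ≡ w * ((1ℤ + 1ℤ * p * b) * (1ℤ + P * p * (ε * a + p * y))) → x₀ ≡ w * (1ℤ + 1ℤ * p * b) →
    y₁ ≡ w * ((1ℤ + p * a) * 1ℤ) → y₀ ≡ w * 1ℤ →
    p * (p * P) ∣ x₁ - x₀ - ε * P * (y₁ - y₀)
  unit-congruence p P ε w a y b refl refl refl refl =
    divides (w * (b * (ε * a + p * y) + y)) (collect w p P ε a y b)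
    where
    collect : ∀ w p P ε a y b →
      w * ((1ℤ + 1ℤ * p * b) * (1ℤ + P * p * (ε * a + p * y))) - w * (1ℤ + 1ℤ * p * b)
          - ε * P * (w * ((1ℤ + p * a) * 1ℤ) - w * 1ℤ)
        ≡ w * (b * (ε * a + p * y) + y) * (p * (p * P))
    collect = ℤ-Solver.solve-∀

  module _ {p : ℕ} (p-prime : Prime p) where

    euclid : ∀ a b → + p ∣ a * b → + p ∣ a ⊎ + p ∣ b
    euclid a b p∣ab with euclidsLemma ℤ.∣ a ∣ ℤ.∣ b ∣ p-prime (subst (p ℕ∣.∣_) (ℤᵖ.abs-* a b) (∣⇒∣ᵤ p∣ab))
    ... | inj₁ p∣a = inj₁ (∣ᵤ⇒∣ p∣a)
    ... | inj₂ p∣b = inj₂ (∣ᵤ⇒∣ p∣b)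

    ∤-* : ∀ {a b} → ¬ + p ∣ a → ¬ + p ∣ b → ¬ + p ∣ a * b
    ∤-* {a} {b} p∤a p∤b p∣ab with euclid a b p∣ab
    ... | inj₁ p∣a = p∤a p∣a
    ... | inj₂ p∣b = p∤b p∣b

    ∤-^ : ∀ {a} n → ¬ + p ∣ a → ¬ + p ∣ a ^ n
    ∤-^ (suc n) p∤a = ∤-* p∤a (∤-^ n p∤a)
    ∤-^ zero    p∤a p∣1 = contradiction
      (ℕ∣.∣1⇒≡1 (∣⇒∣ᵤ p∣1)) (λ p≡1 → ℕ.nonTrivial⇒≢1 {{prime⇒nonTrivial p-prime}} p≡1)

    ^-∣-cancelˡ : ∀ n v {x} → ¬ + p ∣ v → (+ p) ^ n ∣ v * x → (+ p) ^ n ∣ x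
    ^-∣-cancelˡ zero    v {x} p∤v _ = divides x (sym (ℤᵖ.*-identityʳ x))
    ^-∣-cancelˡ (suc n) v {x} p∤v pⁿ⁺¹∣vx
      with euclid v x (∣-trans (divides ((+ p) ^ n) (ℤᵖ.*-comm (+ p) ((+ p) ^ n))) pⁿ⁺¹∣vx)
    ... | inj₁ p∣v = contradiction p∣v p∤v
    ... | inj₂ (divides y refl) = subst ((+ p) ^ suc n ∣_) (ℤᵖ.*-comm (+ p) y)
      (*-monoʳ-∣ (+ p) (^-∣-cancelˡ n v p∤v (*-cancelˡ-∣ (+ p) {{prime⇒nonZero p-prime}}
        (subst ((+ p) ^ suc n ∣_) (swap v y (+ p)) pⁿ⁺¹∣vx))))
      where
      swap : ∀ v y p → v * (y * p) ≡ p * (v * y)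
      swap = ℤ-Solver.solve-∀

    module _ (p≢2 : p ≢ 2) where

      -- Oddness of p enters here: twice this number is p (p - 1), and p does not divide 2.
      p∣triangle : + p ∣ triangle p
      p∣triangle = go p refl
        where
        go : ∀ n → n ≡ p → + p ∣ triangle n
        go zero    _    = divides 0ℤ refl
        go (suc n) refl with euclid (+ 2) (triangle (suc n))
          (divides (+ n) (trans (sym (triangle-double n)) (ℤᵖ.*-comm (+ suc n) (+ n))))
        ... | inj₂ p∣t = p∣t
        ... | inj₁ p∣2 = contradiction
          (ℕᵖ.≤-antisym (ℕ∣.∣⇒≤ (∣⇒∣ᵤ p∣2)) (ℕ.nonTrivial⇒n>1 p {{prime⇒nonTrivial p-prime}})) p≢2

      -- Induction by raising 1 + h, with h = p^(k+1) b, to the power p. The error must be divisible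
      -- by p^(k+3). The cubic term always is, but for k = 0 the quadratic term needs the extra p in
      -- `triangle p`.
      [1+pa]^p^k : ∀ a k → ∃[ y ] (1ℤ + + p * a) ^ (p ℕ.^ k) ≡ 1ℤ + (+ p) ^ k * + p * (a + + p * y)
      [1+pa]^p^k a zero    = 0ℤ , expand (+ p) a
        where
        expand : ∀ p a → (1ℤ + p * a) * 1ℤ ≡ 1ℤ + 1ℤ * p * (a + p * 0ℤ)
        expand = ℤ-Solver.solve-∀
      [1+pa]^p^k a (suc k) with [1+pa]^p^k a k | p∣triangle
      ... | y , eq | divides τ τ-eq with [1+z]^n ((+ p) ^ k * + p * (a + + p * y)) p
      ...   | r , r-eq = y + τ * P * b * b + r * P * P * b * b * b , (begin
        (1ℤ + + p * a) ^ (p ℕ.* p ℕ.^ k)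
          ≡⟨ cong ((1ℤ + + p * a) ^_) (ℕᵖ.*-comm p (p ℕ.^ k)) ⟩
        (1ℤ + + p * a) ^ (p ℕ.^ k ℕ.* p)
          ≡⟨ ℤᵖ.^-*-assoc (1ℤ + + p * a) (p ℕ.^ k) p ⟨
        ((1ℤ + + p * a) ^ (p ℕ.^ k)) ^ p
          ≡⟨ cong (_^ p) eq ⟩
        (1ℤ + h) ^ p
          ≡⟨ trans r-eq (cong (λ t → 1ℤ + + p * h + t * (h * h) + r * (h * h * h)) τ-eq) ⟩
        1ℤ + + p * h + τ * + p * (h * h) + r * (h * h * h)
          ≡⟨ expand (+ p) P b τ r ⟩
        1ℤ + + p * P * + p * (a + + p * y + + p * (τ * P * b * b + r * P * P * b * b * b))
          ≡⟨ cong (λ x → 1ℤ + + p * P * + p * x) (regroup (+ p) a y (τ * P * b * b) (r * P * P * b * b * b)) ⟩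
        1ℤ + + p * P * + p * (a + + p * (y + τ * P * b * b + r * P * P * b * b * b)) ∎)
        where
        open ≡-Reasoning
        P = (+ p) ^ k
        b = a + + p * y
        h = P * + p * b
        expand : ∀ p P b τ r → let h = P * p * b in
          1ℤ + p * h + τ * p * (h * h) + r * (h * h * h)
            ≡ 1ℤ + p * P * p * (b + p * (τ * P * b * b + r * P * P * b * b * b))
        expand = ℤ-Solver.solve-∀
        regroup : ∀ p a y u v → a + p * y + p * (u + v) ≡ a + p * (y + u + v)
        regroup = ℤ-Solver.solve-∀

      -- The e-th power of the previous expansion. Now p^(k+2) is precise enough, and h * h already
      -- contains it, whatever its coefficient.
      [1+pa]^[p^k*e] : ∀ a k e →
        ∃[ y ] (1ℤ + + p * a) ^ (p ℕ.^ k ℕ.* e) ≡ 1ℤ + (+ p) ^ k * + p * (+ e * a + + p * y)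
      [1+pa]^[p^k*e] a k e with [1+pa]^p^k a k
      ... | y , eq with [1+z]^n ((+ p) ^ k * + p * (a + + p * y)) e
      ...   | r , r-eq = + e * y + (triangle e + r * h) * P * b * b ,
        trans (sym (ℤᵖ.^-*-assoc (1ℤ + + p * a) (p ℕ.^ k) e))
          (trans (cong (_^ e) eq) (trans r-eq (trans (expand (+ p) P b (+ e) (triangle e) r)
            (cong (λ x → 1ℤ + P * + p * x) (regroup (+ p) (+ e) a y ((triangle e + r * h) * P * b * b))))))
        where
        P = (+ p) ^ k
        b = a + + p * y
        h = P * + p * b
        expand : ∀ p P b e t r → let h = P * p * b in
          1ℤ + e * h + t * (h * h) + r * (h * h * h)
            ≡ 1ℤ + P * p * (e * b + p * ((t + r * h) * P * b * b))
        expand = ℤ-Solver.solve-∀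
        regroup : ∀ p e a y w → e * (a + p * y) + p * w ≡ e * a + p * (e * y + w)
        regroup = ℤ-Solver.solve-∀

      module _ (m e : ℕ) .{{_ : ℕ.NonZero m}} (2≤e : 2 ≤ e)
               (fermat : ∀ x → + p ∣ + x ⊎ + p ∣ (+ x) ^ m - 1ℤ) where

        -- With m = p - 1 and e = l - 1 this is the index k at which `G c k` involves
        -- `B̂ (l + m * t)`.
        E : ℕ → ℕ
        E t = e ℕ.+ m ℕ.* t

        -- If p ∣ x, every term vanishes separately: the exponents `E s` with s ≥ k are at least 2 +
        -- k, and `E 0`, `E 1` are at least 2 while their coefficient supplies p ^ k. Otherwise x ^
        -- m is some u = 1 + p a and the expansions of powers of u apply.
        power-congruence : ∀ x k ε t → k ≤ t →
          (+ p) ^ (2 ℕ.+ k) ∣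
            (+ x) ^ E (t ℕ.+ p ℕ.^ k ℕ.* ε) - (+ x) ^ E t - + ε * (+ p) ^ k * ((+ x) ^ E 1 - (+ x) ^ E 0)
        power-congruence x k ε t k≤t = [ divisible , unit ]′ (fermat x)
          where
          Goal : Set
          Goal = (+ p) ^ (2 ℕ.+ k) ∣
            (+ x) ^ E (t ℕ.+ p ℕ.^ k ℕ.* ε) - (+ x) ^ E t - + ε * (+ p) ^ k * ((+ x) ^ E 1 - (+ x) ^ E 0)

          divisible : + p ∣ + x → Goal
          divisible p∣x = ∣m∣n⇒∣m-n
            (∣m∣n⇒∣m-n (high (t ℕ.+ p ℕ.^ k ℕ.* ε) (ℕᵖ.≤-trans k≤t (ℕᵖ.m≤m+n t _))) (high t k≤t))
            (p²P∣εPx (+ p) ((+ p) ^ k) (+ ε) (∣m∣n⇒∣m-n (low 1) (low 0)))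
            where
            high : ∀ s → k ≤ s → (+ p) ^ (2 ℕ.+ k) ∣ (+ x) ^ E s
            high s k≤s = ∣⇒^∣^ p∣x (ℕᵖ.+-mono-≤ 2≤e (ℕᵖ.≤-trans k≤s (ℕᵖ.m≤n*m s m)))
            low : ∀ s → (+ p) ^ 2 ∣ (+ x) ^ E s
            low s = ∣⇒^∣^ p∣x (ℕᵖ.≤-trans 2≤e (ℕᵖ.m≤m+n e _))

          unit : + p ∣ (+ x) ^ m - 1ℤ → Goal
          unit p∣x^m-1 =
            unit-congruence (+ p) ((+ p) ^ k) (+ ε) ((+ x) ^ e) a (proj₁ u^d) (+ t * a + + p * proj₁ u^t)
              (trans (x^E (t ℕ.+ p ℕ.^ k ℕ.* ε)) (cong ((+ x) ^ e *_)
                (trans (ℤᵖ.^-distribˡ-+-* u t (p ℕ.^ k ℕ.* ε)) (cong₂ _*_ u^t≡ (proj₂ u^d)))))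
              (trans (x^E t) (cong ((+ x) ^ e *_) u^t≡)) (x^E 1) (x^E 0)
            where
            a u : ℤ
            a = quotient p∣x^m-1
            u = 1ℤ + + p * a
            u^d = [1+pa]^[p^k*e] a k ε
            u^t = [1+pa]^[p^k*e] a 0 t
            u^t≡ : u ^ t ≡ 1ℤ + 1ℤ * + p * (+ t * a + + p * proj₁ u^t)
            u^t≡ = trans (cong (u ^_) (sym (ℕᵖ.*-identityˡ t))) (proj₂ u^t)
            x^m≡u : (+ x) ^ m ≡ u
            x^m≡u = trans (sym (shift ((+ x) ^ m)))
              (cong (_+_ 1ℤ) (trans (_∣_.equality p∣x^m-1) (ℤᵖ.*-comm a (+ p))))
              where
              shift : ∀ v → 1ℤ + (v - 1ℤ) ≡ v
              shift = ℤ-Solver.solve-∀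
            x^E : ∀ s → (+ x) ^ E s ≡ (+ x) ^ e * u ^ s
            x^E s = trans (ℤᵖ.^-distribˡ-+-* (+ x) e (m ℕ.* s))
              (cong ((+ x) ^ e *_) (trans (sym (ℤᵖ.^-*-assoc (+ x) m s)) (cong (_^ s) x^m≡u)))

        moment-congruence : ∀ ws k ε t → k ≤ t →
          (+ p) ^ (2 ℕ.+ k) ∣
            moment ws (E (t ℕ.+ p ℕ.^ k ℕ.* ε)) - moment ws (E t)
              - + ε * (+ p) ^ k * (moment ws (E 1) - moment ws (E 0))
        moment-congruence []             k ε t k≤t = divides 0ℤ (vanish (+ ε * (+ p) ^ k))
          where
          vanish : ∀ x → 0ℤ - 0ℤ - x * (0ℤ - 0ℤ) ≡ 0ℤ
          vanish = ℤ-Solver.solve-∀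
        moment-congruence ((w , x) ∷ ws) k ε t k≤t = subst ((+ p) ^ (2 ℕ.+ k) ∣_)
          (regroup w (M (E (t ℕ.+ p ℕ.^ k ℕ.* ε))) (M (E t)) (M (E 1)) (M (E 0)) (+ ε * (+ p) ^ k)
             (moment ws (E (t ℕ.+ p ℕ.^ k ℕ.* ε))) (moment ws (E t)) (moment ws (E 1)) (moment ws (E 0)))
          (∣m∣n⇒∣m+n
            (∣n⇒∣m*n w (subst ((+ p) ^ (2 ℕ.+ k) ∣_)
              (cong₂ (λ u v → u - v) (cong₂ _-_ (sym (pos-^ x (E (t ℕ.+ p ℕ.^ k ℕ.* ε)))) (sym (pos-^ x (E t))))
                (cong (+ ε * (+ p) ^ k *_) (cong₂ _-_ (sym (pos-^ x (E 1))) (sym (pos-^ x (E 0))))))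
              (power-congruence x k ε t k≤t)))
            (moment-congruence ws k ε t k≤t))
          where
          M : ℕ → ℤ
          M j = + (x ℕ.^ j)
          regroup : ∀ w x y z s c x′ y′ z′ s′ →
            w * (x - y - c * (z - s)) + (x′ - y′ - c * (z′ - s′))
              ≡ (w * x + x′) - (w * y + y′) - c * ((w * z + z′) - (w * s + s′))
          regroup = ℤ-Solver.solve-∀

        module _ (ws : List (ℤ × ℕ)) (simple : ¬ (+ p) ^ 2 ∣ moment ws (E 1) - moment ws (E 0)) where

          -- By the congruence, p^(k+2) divides ε p^k (M 1 - M 0). If p did not divide ε, cancelling
          -- ε p^k would leave p² ∣ M 1 - M 0.
          ∣-next-digit : ∀ k ε t → k ≤ t →
            (+ p) ^ (2 ℕ.+ k) ∣ moment ws (E (t ℕ.+ p ℕ.^ k ℕ.* ε)) - moment ws (E t) → + p ∣ + ε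
          ∣-next-digit k ε t k≤t div = decidable-stable (+ p ∣? + ε) λ p∤ε →
            simple (^-∣-cancelˡ 2 (+ ε) p∤ε (p²∣εx (+ p) ((+ p) ^ k) (+ ε)
              (∣-cancel div (moment-congruence ws k ε t k≤t))))
            where
            instance
              P≢0 : ℤ.NonZero ((+ p) ^ k)
              P≢0 = subst ℤ.NonZero (pos-^ p k) (ℕᵖ.m^n≢0 p k {{prime⇒nonZero p-prime}})

          -- The digits of d are shown to vanish one at a time. The slope M 1 - M 0 may absorb one
          -- factor p, hence exponent n + 1 in the hypothesis against n in the conclusion.
          moment-separates : ∀ n t d → n ≤ t →
            (+ p) ^ suc n ∣ moment ws (E (t ℕ.+ d)) - moment ws (E t) →
            ∀ k → k ≤ n → p ℕ.^ k ℕ∣.∣ d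
          moment-separates n t d n≤t div zero    k≤n = ℕ∣.1∣ d
          moment-separates n t d n≤t div (suc k) k<n =
            next (moment-separates n t d n≤t div k (ℕᵖ.<⇒≤ k<n))
            where
            next : p ℕ.^ k ℕ∣.∣ d → p ℕ.^ suc k ℕ∣.∣ d
            next (ℕ∣.divides ε d≡) = subst (p ℕ.^ suc k ℕ∣.∣_) (sym d≡)
              (ℕ∣.*-monoˡ-∣ (p ℕ.^ k) (∣⇒∣ᵤ (∣-next-digit k ε t (ℕᵖ.≤-trans (ℕᵖ.<⇒≤ k<n) n≤t)
                (∣-trans (∣⇒^∣^ {+ p} ∣-refl (s≤s k<n))
                  (subst (λ d → (+ p) ^ suc n ∣ moment ws (E (t ℕ.+ d)) - moment ws (E t))
                         (trans d≡ (ℕᵖ.*-comm ε (p ℕ.^ k))) div)))))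

open import Data.Rational.Base using (_+_; _*_; _-_; -_)

-- ℤ inside ℚ

ℚ-ring : AlmostCommutativeRing 0ℓ 0ℓ
ℚ-ring = fromCommutativeRing ℚᵖ.+-*-commutativeRing λ x → dec⇒maybe (0ℚ ℚᵖ.≟ x)

toℚᵘ-fromℤ : ∀ z → toℚᵘ (fromℤ z) ℚᵘ.≃ mkℚᵘ z 0
toℚᵘ-fromℤ z = ℚᵖ.toℚᵘ-fromℚᵘ (mkℚᵘ z 0)

fromℤ-* : ∀ a b → fromℤ (a ℤ.* b) ≡ fromℤ a * fromℤ b
fromℤ-* a b = ℚᵖ.toℚᵘ-injective (begin
  toℚᵘ (fromℤ (a ℤ.* b))                ≈⟨ toℚᵘ-fromℤ (a ℤ.* b) ⟩
  mkℚᵘ a 0 ℚᵘ.* mkℚᵘ b 0                ≈⟨ ℚᵘᵖ.*-cong (toℚᵘ-fromℤ a) (toℚᵘ-fromℤ b) ⟨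
  toℚᵘ (fromℤ a) ℚᵘ.* toℚᵘ (fromℤ b)    ≈⟨ ℚᵖ.toℚᵘ-homo-* (fromℤ a) (fromℤ b) ⟨
  toℚᵘ (fromℤ a * fromℤ b)              ∎)
  where open ℚᵘᵖ.≃-Reasoning

fromℤ-+ : ∀ a b → fromℤ (a ℤ.+ b) ≡ fromℤ a + fromℤ b
fromℤ-+ a b = ℚᵖ.toℚᵘ-injective (begin
  toℚᵘ (fromℤ (a ℤ.+ b))                ≈⟨ toℚᵘ-fromℤ (a ℤ.+ b) ⟩
  mkℚᵘ (a ℤ.+ b) 0                      ≡⟨ cong₂ (λ x y → mkℚᵘ (x ℤ.+ y) 0) (ℤᵖ.*-identityʳ a) (ℤᵖ.*-identityʳ b) ⟨
  mkℚᵘ a 0 ℚᵘ.+ mkℚᵘ b 0                ≈⟨ ℚᵘᵖ.+-cong (toℚᵘ-fromℤ a) (toℚᵘ-fromℤ b) ⟨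
  toℚᵘ (fromℤ a) ℚᵘ.+ toℚᵘ (fromℤ b)    ≈⟨ ℚᵖ.toℚᵘ-homo-+ (fromℤ a) (fromℤ b) ⟨
  toℚᵘ (fromℤ a + fromℤ b)              ∎)
  where open ℚᵘᵖ.≃-Reasoning

fromℤ-neg : ∀ a → fromℤ (ℤ.- a) ≡ - fromℤ a
fromℤ-neg a = ℚᵖ.toℚᵘ-injective (begin
  toℚᵘ (fromℤ (ℤ.- a))    ≈⟨ toℚᵘ-fromℤ (ℤ.- a) ⟩
  ℚᵘ.- mkℚᵘ a 0           ≈⟨ ℚᵘᵖ.-‿cong (toℚᵘ-fromℤ a) ⟨
  ℚᵘ.- toℚᵘ (fromℤ a)     ≈⟨ ℚᵖ.toℚᵘ-homo‿- (fromℤ a) ⟨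
  toℚᵘ (- fromℤ a)        ∎)
  where open ℚᵘᵖ.≃-Reasoning

fromℤ-- : ∀ a b → fromℤ (a ℤ.- b) ≡ fromℤ a - fromℤ b
fromℤ-- a b = trans (fromℤ-+ a (ℤ.- b)) (cong (_+_ (fromℤ a)) (fromℤ-neg b))

fromℤ-injective : ∀ {a b} → fromℤ a ≡ fromℤ b → a ≡ b
fromℤ-injective {a} {b} eq with ℚᵘᵖ.≃-trans (ℚᵘᵖ.≃-sym (toℚᵘ-fromℤ a))
  (ℚᵘᵖ.≃-trans (ℚᵘᵖ.≃-reflexive (cong toℚᵘ eq)) (toℚᵘ-fromℤ b))
... | *≡* a*1≡b*1 = trans (sym (ℤᵖ.*-identityʳ a)) (trans a*1≡b*1 (ℤᵖ.*-identityʳ b))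

fromℕ-+ : ∀ m n → fromℕ (m ℕ.+ n) ≡ fromℕ m + fromℕ n
fromℕ-+ m n = fromℤ-+ (+ m) (+ n)

fromℕ-* : ∀ m n → fromℕ (m ℕ.* n) ≡ fromℕ m * fromℕ n
fromℕ-* m n = trans (cong fromℤ (ℤᵖ.pos-* m n)) (fromℤ-* (+ m) (+ n))

recip-inverseʳ : ∀ n → fromℕ (suc n) * recip (suc n) ≡ 1ℚ
recip-inverseʳ n = ℚᵖ.toℚᵘ-injective (begin
  toℚᵘ (fromℕ (suc n) * recip (suc n))              ≈⟨ ℚᵖ.toℚᵘ-homo-* (fromℕ (suc n)) (recip (suc n)) ⟩
  toℚᵘ (fromℕ (suc n)) ℚᵘ.* toℚᵘ (recip (suc n))    ≈⟨ ℚᵘᵖ.*-cong (toℚᵘ-fromℤ (+ suc n)) (ℚᵖ.toℚᵘ-fromℚᵘ (mkℚᵘ (+ 1) n)) ⟩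
  mkℚᵘ (+ suc n) 0 ℚᵘ.* mkℚᵘ (+ 1) n                ≈⟨ *≡* cross ⟩
  ℚᵘ.1ℚᵘ                                            ∎)
  where
  open ℚᵘᵖ.≃-Reasoning
  cross : + suc n ℤ.* + 1 ℤ.* + 1 ≡ + 1 ℤ.* + suc (n ℕ.+ 0)
  cross = trans (ℤᵖ.*-identityʳ (+ suc n ℤ.* + 1)) (trans (ℤᵖ.*-comm (+ suc n) (+ 1))
    (cong (λ k → + 1 ℤ.* + k) (sym (ℕᵖ.+-identityʳ (suc n)))))

fromℕ-suc-cancel : ∀ n {q r} → fromℕ (suc n) * q ≡ fromℕ (suc n) * r → q ≡ r
fromℕ-suc-cancel n {q} {r} eq = begin
  q                                     ≡⟨ expand q ⟩
  recip (suc n) * (fromℕ (suc n) * q)   ≡⟨ cong (recip (suc n) *_) eq ⟩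
  recip (suc n) * (fromℕ (suc n) * r)   ≡⟨ expand r ⟨
  r                                     ∎
  where
  open ≡-Reasoning
  swap : ∀ x y q → (x * y) * q ≡ y * (x * q)
  swap = solve-∀ ℚ-ring
  expand : ∀ q → q ≡ recip (suc n) * (fromℕ (suc n) * q)
  expand q = begin
    q                                     ≡⟨ ℚᵖ.*-identityˡ q ⟨
    1ℚ * q                                ≡⟨ cong (_* q) (recip-inverseʳ n) ⟨
    fromℕ (suc n) * recip (suc n) * q     ≡⟨ swap (fromℕ (suc n)) (recip (suc n)) q ⟩
    recip (suc n) * (fromℕ (suc n) * q)   ∎

-- Bernoulli numbers and moments

-- Think of a sequence a as the linear functional x ^ k ↦ a k on polynomials;
-- then S y a k is the value of a at (x + y) ^ k.
S : ℕ → (ℕ → ℚ) → (ℕ → ℚ)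
S y a zero    = a 0
S y a (suc k) = S y (a ∘ suc) k + fromℕ y * S y a k

-- On exponential generating functions, D is multiplication by z.
D : (ℕ → ℚ) → (ℕ → ℚ)
D a zero    = 0ℚ
D a (suc k) = fromℕ (suc k) * a k

-- The functional of evaluation at x; pow 0 is 1, 0, 0, ….
pow : ℕ → ℕ → ℚ
pow x k = fromℕ (x ℕ.^ k)

S-cong : ∀ y {a b} → a ≗ b → S y a ≗ S y b
S-cong y a≗b zero    = a≗b 0
S-cong y a≗b (suc k) = cong₂ (λ u v → u + fromℕ y * v) (S-cong y (a≗b ∘ suc) k) (S-cong y a≗b k)

S-+ : ∀ y a b k → S y (λ i → a i + b i) k ≡ S y a k + S y b k
S-+ y a b zero    = refl
S-+ y a b (suc k) = trans
  (cong₂ (λ u v → u + fromℕ y * v) (S-+ y (a ∘ suc) (b ∘ suc) k) (S-+ y a b k))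
  (rearrange (S y (a ∘ suc) k) (S y (b ∘ suc) k) (fromℕ y) (S y a k) (S y b k))
  where
  rearrange : ∀ u v y s t → (u + v) + y * (s + t) ≡ (u + y * s) + (v + y * t)
  rearrange = solve-∀ ℚ-ring

S-* : ∀ y r a k → S y (λ i → r * a i) k ≡ r * S y a k
S-* y r a zero    = refl
S-* y r a (suc k) = trans
  (cong₂ (λ u v → u + fromℕ y * v) (S-* y r (a ∘ suc) k) (S-* y r a k))
  (rearrange r (S y (a ∘ suc) k) (fromℕ y) (S y a k))
  where
  rearrange : ∀ r u y s → r * u + y * (r * s) ≡ r * (u + y * s)
  rearrange = solve-∀ ℚ-ring

S-- : ∀ y a b k → S y (λ i → a i - b i) k ≡ S y a k - S y b k
S-- y a b k = begin
  S y (λ i → a i - b i) k             ≡⟨ S-cong y (λ i → negate (a i) (b i)) k ⟩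
  S y (λ i → a i + - 1ℚ * b i) k      ≡⟨ S-+ y a (λ i → - 1ℚ * b i) k ⟩
  S y a k + S y (λ i → - 1ℚ * b i) k  ≡⟨ cong (_+_ (S y a k)) (S-* y (- 1ℚ) b k) ⟩
  S y a k + - 1ℚ * S y b k            ≡⟨ negate (S y a k) (S y b k) ⟨
  S y a k - S y b k                   ∎
  where
  open ≡-Reasoning
  negate : ∀ u v → u - v ≡ u + - 1ℚ * v
  negate = solve-∀ ℚ-ring

S-pow : ∀ y x k → S y (pow x) k ≡ pow (x ℕ.+ y) k
S-pow y x zero    = refl
S-pow y x (suc k) = begin
  S y (λ i → fromℕ (x ℕ.* x ℕ.^ i)) k + fromℕ y * S y (pow x) k
    ≡⟨ cong (_+ fromℕ y * S y (pow x) k) (trans (S-cong y (λ i → fromℕ-* x (x ℕ.^ i)) k) (S-* y (fromℕ x) (pow x) k)) ⟩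
  fromℕ x * S y (pow x) k + fromℕ y * S y (pow x) k
    ≡⟨ ℚᵖ.*-distribʳ-+ (S y (pow x) k) (fromℕ x) (fromℕ y) ⟨
  (fromℕ x + fromℕ y) * S y (pow x) k
    ≡⟨ cong₂ _*_ (sym (fromℕ-+ x y)) (S-pow y x k) ⟩
  fromℕ (x ℕ.+ y) * pow (x ℕ.+ y) k
    ≡⟨ fromℕ-* (x ℕ.+ y) ((x ℕ.+ y) ℕ.^ k) ⟨
  pow (x ℕ.+ y) (suc k) ∎
  where open ≡-Reasoning

S-S : ∀ x y a k → S x (S y a) k ≡ S (x ℕ.+ y) a k
S-S x y a zero    = refl
S-S x y a (suc k) = begin
  S x (λ i → S y (a ∘ suc) i + fromℕ y * S y a i) k + fromℕ x * S x (S y a) k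
    ≡⟨ cong (_+ fromℕ x * S x (S y a) k) (trans (S-+ x _ _ k) (cong (_+_ (S x (S y (a ∘ suc)) k)) (S-* x (fromℕ y) (S y a) k))) ⟩
  S x (S y (a ∘ suc)) k + fromℕ y * S x (S y a) k + fromℕ x * S x (S y a) k
    ≡⟨ cong₂ (λ u v → u + fromℕ y * v + fromℕ x * v) (S-S x y (a ∘ suc) k) (S-S x y a k) ⟩
  S (x ℕ.+ y) (a ∘ suc) k + fromℕ y * S (x ℕ.+ y) a k + fromℕ x * S (x ℕ.+ y) a k
    ≡⟨ rearrange (S (x ℕ.+ y) (a ∘ suc) k) (fromℕ x) (fromℕ y) (S (x ℕ.+ y) a k) ⟩
  S (x ℕ.+ y) (a ∘ suc) k + (fromℕ x + fromℕ y) * S (x ℕ.+ y) a k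
    ≡⟨ cong (λ u → S (x ℕ.+ y) (a ∘ suc) k + u * S (x ℕ.+ y) a k) (fromℕ-+ x y) ⟨
  S (x ℕ.+ y) a (suc k) ∎
  where
  open ≡-Reasoning
  rearrange : ∀ u x y s → u + y * s + x * s ≡ u + (x + y) * s
  rearrange = solve-∀ ℚ-ring

S-zero : ∀ a → S 0 a ≗ a
S-zero a zero    = refl
S-zero a (suc k) = trans (cong₂ _+_ (S-zero (a ∘ suc) k) (ℚᵖ.*-zeroˡ (S 0 a k))) (ℚᵖ.+-identityʳ _)

fromℕ-suc : ∀ n → fromℕ (suc n) ≡ 1ℚ + fromℕ n
fromℕ-suc = fromℕ-+ 1

-- Dropping the first term differentiates an exponential generating function A, so this is the
-- product rule (z A)' = z A' + A.
D-suc : ∀ a k → D a (suc k) ≡ D (a ∘ suc) k + a k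
D-suc a zero    = trans (ℚᵖ.*-identityˡ (a 0)) (sym (ℚᵖ.+-identityˡ (a 0)))
D-suc a (suc k) = trans (cong (_* a (suc k)) (fromℕ-suc (suc k))) (rearrange (fromℕ (suc k)) (a (suc k)))
  where
  rearrange : ∀ n x → (1ℚ + n) * x ≡ n * x + x
  rearrange = solve-∀ ℚ-ring

D-cong : ∀ {a b} → a ≗ b → D a ≗ D b
D-cong a≗b zero    = refl
D-cong a≗b (suc k) = cong (fromℕ (suc k) *_) (a≗b k)

D-+ : ∀ a b k → D (λ i → a i + b i) k ≡ D a k + D b k
D-+ a b zero    = refl
D-+ a b (suc k) = ℚᵖ.*-distribˡ-+ (fromℕ (suc k)) (a k) (b k)

D-* : ∀ r a k → D (λ i → r * a i) k ≡ r * D a k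
D-* r a zero    = sym (ℚᵖ.*-zeroʳ r)
D-* r a (suc k) = swap r (fromℕ (suc k)) (a k)
  where
  swap : ∀ r n x → n * (r * x) ≡ r * (n * x)
  swap = solve-∀ ℚ-ring

D-injective : ∀ {a b} → D a ≗ D b → a ≗ b
D-injective Da≗Db k = fromℕ-suc-cancel k (Da≗Db (suc k))

S-D : ∀ y a k → S y (D a) k ≡ D (S y a) k
S-D y a zero    = refl
S-D y a (suc k) = begin
  S y (D a ∘ suc) k + fromℕ y * S y (D a) k
    ≡⟨ cong (_+ fromℕ y * S y (D a) k) (trans (S-cong y (D-suc a) k) (S-+ y (D (a ∘ suc)) a k)) ⟩
  S y (D (a ∘ suc)) k + S y a k + fromℕ y * S y (D a) k
    ≡⟨ cong₂ (λ u v → u + S y a k + fromℕ y * v) (S-D y (a ∘ suc) k) (S-D y a k) ⟩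
  D (S y (a ∘ suc)) k + S y a k + fromℕ y * D (S y a) k
    ≡⟨ swap (D (S y (a ∘ suc)) k) (S y a k) (fromℕ y * D (S y a) k) ⟩
  D (S y (a ∘ suc)) k + fromℕ y * D (S y a) k + S y a k
    ≡⟨ cong (_+ S y a k) (trans (D-+ (S y (a ∘ suc)) (λ i → fromℕ y * S y a i) k) (cong (_+_ (D (S y (a ∘ suc)) k)) (D-* (fromℕ y) (S y a) k))) ⟨
  D (S y a ∘ suc) k + S y a k
    ≡⟨ D-suc (S y a) k ⟨
  D (S y a) (suc k) ∎
  where
  open ≡-Reasoning
  swap : ∀ u v w → u + v + w ≡ u + w + v
  swap = solve-∀ ℚ-ring

-- Substituting c z for z in e^z A(z) gives e^(cz) A(c z).
S-dilate : ∀ c a k → S c (λ i → pow c i * a i) k ≡ pow c k * S 1 a k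
S-dilate c a zero    = refl
S-dilate c a (suc k) = begin
  S c (λ i → pow c (suc i) * a (suc i)) k + fromℕ c * S c (λ i → pow c i * a i) k
    ≡⟨ cong (_+ fromℕ c * S c (λ i → pow c i * a i) k) (trans
         (S-cong c (λ i → trans (cong (_* a (suc i)) (fromℕ-* c (c ℕ.^ i)))
                                (ℚᵖ.*-assoc (fromℕ c) (pow c i) (a (suc i)))) k)
         (S-* c (fromℕ c) (λ i → pow c i * a (suc i)) k)) ⟩
  fromℕ c * S c (λ i → pow c i * a (suc i)) k + fromℕ c * S c (λ i → pow c i * a i) k
    ≡⟨ cong₂ (λ u v → fromℕ c * u + fromℕ c * v) (S-dilate c (a ∘ suc) k) (S-dilate c a k) ⟩
  fromℕ c * (pow c k * S 1 (a ∘ suc) k) + fromℕ c * (pow c k * S 1 a k)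
    ≡⟨ factor (fromℕ c) (pow c k) (S 1 (a ∘ suc) k) (S 1 a k) ⟩
  (fromℕ c * pow c k) * S 1 a (suc k)
    ≡⟨ cong (_* S 1 a (suc k)) (fromℕ-* c (c ℕ.^ k)) ⟨
  pow c (suc k) * S 1 a (suc k) ∎
  where
  open ≡-Reasoning
  factor : ∀ c x u v → c * (x * u) + c * (x * v) ≡ (c * x) * (u + 1ℚ * v)
  factor = solve-∀ ℚ-ring

-- Ordinary coefficients and the shift of the Bernoulli sequence

∂ : (ℕ → ℚ) → (ℕ → ℚ)
∂ a k = fromℕ (suc k) * a (suc k)

⊛-congˡ : ∀ {a a′} b → a ≗ a′ → a ⊛ b ≗ a′ ⊛ b
⊛-congˡ b a≗a′ zero    = cong (_* b 0) (a≗a′ 0)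
⊛-congˡ b a≗a′ (suc n) = cong₂ (λ u v → u * b (suc n) + v) (a≗a′ 0) (⊛-congˡ b (a≗a′ ∘ suc) n)

⊛-distribʳ-+ : ∀ a a′ b n → ((λ k → a k + a′ k) ⊛ b) n ≡ (a ⊛ b) n + (a′ ⊛ b) n
⊛-distribʳ-+ a a′ b zero    = ℚᵖ.*-distribʳ-+ (b 0) (a 0) (a′ 0)
⊛-distribʳ-+ a a′ b (suc n) = trans
  (cong (_+_ ((a 0 + a′ 0) * b (suc n))) (⊛-distribʳ-+ (a ∘ suc) (a′ ∘ suc) b n))
  (rearrange (a 0) (a′ 0) (b (suc n)) (((a ∘ suc) ⊛ b) n) (((a′ ∘ suc) ⊛ b) n))
  where
  rearrange : ∀ x y z u v → (x + y) * z + (u + v) ≡ (x * z + u) + (y * z + v)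
  rearrange = solve-∀ ℚ-ring

∂-⊛ : ∀ a b n → ∂ (a ⊛ b) n ≡ (∂ a ⊛ b) n + (a ⊛ ∂ b) n
∂-⊛ a b zero    = rearrange (a 0) (a 1) (b 0) (b 1)
  where
  rearrange : ∀ a₀ a₁ b₀ b₁ → 1ℚ * (a₀ * b₁ + a₁ * b₀) ≡ 1ℚ * a₁ * b₀ + a₀ * (1ℚ * b₁)
  rearrange = solve-∀ ℚ-ring
∂-⊛ a b (suc n) = begin
  fromℕ (suc (suc n)) * (a 0 * b (suc (suc n)) + P)
    ≡⟨ distrib (fromℕ (suc (suc n))) (a 0) (b (suc (suc n))) P ⟩
  a 0 * ∂ b (suc n) + fromℕ (suc (suc n)) * P
    ≡⟨ cong (_+_ (a 0 * ∂ b (suc n))) (suc-* (suc n) P) ⟩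
  a 0 * ∂ b (suc n) + (P + ∂ ((a ∘ suc) ⊛ b) n)
    ≡⟨ cong (λ u → a 0 * ∂ b (suc n) + (P + u)) (∂-⊛ (a ∘ suc) b n) ⟩
  a 0 * ∂ b (suc n) + ((a 1 * b (suc n) + P₂) + ((∂ (a ∘ suc) ⊛ b) n + P₁))
    ≡⟨ regroup (a 0 * ∂ b (suc n)) (a 1) (b (suc n)) P₂ ((∂ (a ∘ suc) ⊛ b) n) P₁ ⟩
  1ℚ * a 1 * b (suc n) + (P₂ + (∂ (a ∘ suc) ⊛ b) n) + (a 0 * ∂ b (suc n) + P₁)
    ≡⟨ cong (λ u → 1ℚ * a 1 * b (suc n) + u + (a 0 * ∂ b (suc n) + P₁))
         (trans (⊛-congˡ b (λ k → suc-* (suc k) (a (suc (suc k)))) n)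
                (⊛-distribʳ-+ (a ∘ suc ∘ suc) (∂ (a ∘ suc)) b n)) ⟨
  (∂ a ⊛ b) (suc n) + (a ⊛ ∂ b) (suc n) ∎
  where
  open ≡-Reasoning
  P  = ((a ∘ suc) ⊛ b) (suc n)
  P₁ = ((a ∘ suc) ⊛ ∂ b) n
  P₂ = ((a ∘ suc ∘ suc) ⊛ b) n
  distrib : ∀ m x y p → m * (x * y + p) ≡ x * (m * y) + m * p
  distrib = solve-∀ ℚ-ring
  expand : ∀ m p → (1ℚ + m) * p ≡ p + m * p
  expand = solve-∀ ℚ-ring
  suc-* : ∀ m p → fromℕ (suc m) * p ≡ p + fromℕ m * p
  suc-* m p = trans (cong (_* p) (fromℕ-suc m)) (expand (fromℕ m) p)
  regroup : ∀ w x y p₂ q p₁ → w + ((x * y + p₂) + (q + p₁)) ≡ 1ℚ * x * y + (p₂ + q) + (w + p₁)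
  regroup = solve-∀ ℚ-ring

exp : ℕ → ℚ
exp k = recip (k !)

recip-* : ∀ m n .{{_ : ℕ.NonZero n}} → fromℕ (suc m) * recip (suc m ℕ.* n) ≡ recip n
recip-* m (suc n) = fromℕ-suc-cancel n (begin
  fromℕ (suc n) * (fromℕ (suc m) * r)   ≡⟨ swap (fromℕ (suc n)) (fromℕ (suc m)) r ⟩
  fromℕ (suc m) * fromℕ (suc n) * r     ≡⟨ cong (_* r) (fromℕ-* (suc m) (suc n)) ⟨
  fromℕ (suc m ℕ.* suc n) * r           ≡⟨ recip-inverseʳ (n ℕ.+ m ℕ.* suc n) ⟩
  1ℚ                                    ≡⟨ recip-inverseʳ n ⟨
  fromℕ (suc n) * recip (suc n)         ∎)
  where
  open ≡-Reasoning
  r = recip (suc m ℕ.* suc n)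
  swap : ∀ x y z → x * (y * z) ≡ y * x * z
  swap = solve-∀ ℚ-ring

∂-exp : ∂ exp ≗ exp
∂-exp k = recip-* k (k !) {{k ℕᵖ.!≢0}}

fromℕ-!-∂ : ∀ a k → fromℕ (suc k !) * a (suc k) ≡ fromℕ (k !) * ∂ a k
fromℕ-!-∂ a k = trans (cong (_* a (suc k)) (fromℕ-* (suc k) (k !))) (swap (fromℕ (suc k)) (fromℕ (k !)) (a (suc k)))
  where
  swap : ∀ x y z → x * y * z ≡ y * (x * z)
  swap = solve-∀ ℚ-ring

-- The factor i ! converts ordinary to exponential coefficients, under which `S 1` is multiplication
-- by e^z. The induction compares derivatives: (e^z A)' = e^z A + e^z A'.
S-egf : ∀ a k → S 1 (λ i → fromℕ (i !) * a i) k ≡ fromℕ (k !) * (exp ⊛ a) k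
S-egf a zero    = sym (cong (1ℚ *_) (ℚᵖ.*-identityˡ (a 0)))
S-egf a (suc k) = begin
  S 1 (λ i → fromℕ (suc i !) * a (suc i)) k + 1ℚ * S 1 (λ i → fromℕ (i !) * a i) k
    ≡⟨ cong₂ (λ u v → u + 1ℚ * v) (trans (S-cong 1 (fromℕ-!-∂ a) k) (S-egf (∂ a) k)) (S-egf a k) ⟩
  fromℕ (k !) * (exp ⊛ ∂ a) k + 1ℚ * (fromℕ (k !) * (exp ⊛ a) k)
    ≡⟨ factor (fromℕ (k !)) ((exp ⊛ ∂ a) k) ((exp ⊛ a) k) ⟩
  fromℕ (k !) * ((exp ⊛ a) k + (exp ⊛ ∂ a) k)
    ≡⟨ cong (λ u → fromℕ (k !) * (u + (exp ⊛ ∂ a) k)) (⊛-congˡ a ∂-exp k) ⟨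
  fromℕ (k !) * ((∂ exp ⊛ a) k + (exp ⊛ ∂ a) k)
    ≡⟨ cong (fromℕ (k !) *_) (∂-⊛ exp a k) ⟨
  fromℕ (k !) * ∂ (exp ⊛ a) k
    ≡⟨ fromℕ-!-∂ (exp ⊛ a) k ⟨
  fromℕ (suc k !) * (exp ⊛ a) (suc k) ∎
  where
  open ≡-Reasoning
  factor : ∀ f u v → f * u + 1ℚ * (f * v) ≡ f * (v + u)
  factor = solve-∀ ℚ-ring

-- This is e^z * z / (e^z - 1) = z / (e^z - 1) + z; the sequence of z is `D (pow 0)`. The series
-- `exp` and `exp-1` differ only in the constant term, so `⊛-inverse` evaluates the rest of the
-- product.
S-B : ∀ k → S 1 B k ≡ B k + D (pow 0) k
S-B zero    = refl
S-B (suc k) = begin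
  S 1 B (suc k)
    ≡⟨ S-egf z/[exp-1] (suc k) ⟩
  fromℕ (suc k !) * (1ℚ * z/[exp-1] (suc k) + ((exp-1 ∘ suc) ⊛ z/[exp-1]) k)
    ≡⟨ cong (λ u → fromℕ (suc k !) * (1ℚ * z/[exp-1] (suc k) + u)) (⊛-inverse (exp-1 ∘ suc) refl k) ⟩
  fromℕ (suc k !) * (1ℚ * z/[exp-1] (suc k) + one k)
    ≡⟨ distrib (fromℕ (suc k !)) (z/[exp-1] (suc k)) (one k) ⟩
  B (suc k) + fromℕ (suc k !) * one k
    ≡⟨ cong (_+_ (B (suc k))) (!-one k) ⟩
  B (suc k) + fromℕ (suc k) * pow 0 k ∎
  where
  open ≡-Reasoning
  distrib : ∀ f w o → f * (1ℚ * w + o) ≡ f * w + f * o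
  distrib = solve-∀ ℚ-ring
  !-one : ∀ k → fromℕ (suc k !) * one k ≡ fromℕ (suc k) * pow 0 k
  !-one zero    = refl
  !-one (suc k) = trans (ℚᵖ.*-zeroʳ (fromℕ (suc (suc k) !))) (sym (ℚᵖ.*-zeroʳ (fromℕ (suc (suc k)))))

Σ< : ℕ → (ℕ → ℚ) → ℚ
Σ< zero    f = 0ℚ
Σ< (suc n) f = Σ< n f + f n

S-const-0 : ∀ y k → S y (λ _ → 0ℚ) k ≡ 0ℚ
S-const-0 y k = trans (S-* y 0ℚ (λ _ → 0ℚ) k) (ℚᵖ.*-zeroˡ (S y (λ _ → 0ℚ) k))

module _
  (Q : ℚ → Set) (Q-0 : Q 0ℚ) (Q-+ : ∀ {x y} → Q x → Q y → Q (x + y))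
  (Q-* : ∀ n {x} → Q x → Q (fromℕ n * x)) where

  -- (x + y)^k - x^k combines lower powers of x with natural coefficients, so any Q closed under
  -- sums and natural multiples is inherited. Q will be vanishing, p-integrality or, in the next
  -- lemma, divisibility by p.
  S-local : ∀ y a k → (∀ j → j < k → Q (a j)) → Q (S y a k - a k)
  S-local y a zero    Qa = subst Q (sym (ℚᵖ.+-inverseʳ (a 0))) Q-0
  S-local y a (suc k) Qa = subst Q (regroup (S y (a ∘ suc) k) (a (suc k)) (fromℕ y) (S y a k) (a k))
    (Q-+ (S-local y (a ∘ suc) k (λ j j<k → Qa (suc j) (s≤s j<k)))
         (Q-* y (Q-+ (S-local y a k (λ j j<k → Qa j (ℕᵖ.m<n⇒m<1+n j<k))) (Qa k ℕᵖ.≤-refl))))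
    where
    regroup : ∀ u v y s t → (u - v) + y * ((s - t) + t) ≡ (u + y * s) - v
    regroup = solve-∀ ℚ-ring

  -- One order further: (x + 1)^(k+1) - x^(k+1) - (k + 1) x^k has degree below k.
  S-local-suc : ∀ a k → (∀ j → j < k → Q (a j)) →
                Q (S 1 a (suc k) - a (suc k) - fromℕ (suc k) * a k)
  S-local-suc a zero    Qa = subst Q (cancel (a 0) (a 1)) Q-0
    where
    cancel : ∀ a₀ a₁ → 0ℚ ≡ (a₁ + 1ℚ * a₀) - a₁ - 1ℚ * a₀
    cancel = solve-∀ ℚ-ring
  S-local-suc a (suc k) Qa = subst Q
    (trans (regroup (S 1 (a ∘ suc) (suc k)) (a (suc (suc k))) (fromℕ (suc k)) (S 1 a (suc k)) (a (suc k)))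
           (cong (λ n → S 1 a (suc (suc k)) - a (suc (suc k)) - n * a (suc k)) (sym (fromℕ-suc (suc k)))))
    (Q-+ (S-local-suc (a ∘ suc) k (λ j j<k → Qa (suc j) (s≤s j<k))) (S-local 1 a (suc k) Qa))
    where
    regroup : ∀ u v n s t → (u - v - n * t) + (s - t) ≡ (u + 1ℚ * s) - v - (1ℚ + n) * t
    regroup = solve-∀ ℚ-ring

≡0-+ : ∀ {x y} → x ≡ 0ℚ → y ≡ 0ℚ → x + y ≡ 0ℚ
≡0-+ x≡0 y≡0 = cong₂ _+_ x≡0 y≡0

≡0-* : ∀ n {x} → x ≡ 0ℚ → fromℕ n * x ≡ 0ℚ
≡0-* n x≡0 = trans (cong (fromℕ n *_) x≡0) (ℚᵖ.*-zeroʳ (fromℕ n))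

S-local-0 : ∀ y a k → (∀ j → j < k → a j ≡ 0ℚ) → S y a k - a k ≡ 0ℚ
S-local-0 = S-local (_≡ 0ℚ) refl ≡0-+ ≡0-*

-- Multiplication by e^z - 1 is injective: once the lower terms vanish, degree n + 1 of (e^z - 1) A
-- is (n + 1) * a n. This cancels e^z - 1 without dividing power series.
S-fixed⇒0 : ∀ a → S 1 a ≗ a → ∀ n j → j < n → a j ≡ 0ℚ
S-fixed⇒0 a Sa≗a (suc n) j (s≤s j≤n) with ℕᵖ.m≤n⇒m<n∨m≡n j≤n
... | inj₁ j<n  = S-fixed⇒0 a Sa≗a n j j<n
... | inj₂ refl = fromℕ-suc-cancel n (begin
  fromℕ (suc n) * a n
    ≡⟨ regroup (a (suc n)) (fromℕ (suc n) * a n) ⟩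
  - (a (suc n) - a (suc n) - fromℕ (suc n) * a n)
    ≡⟨ cong (λ u → - (u - a (suc n) - fromℕ (suc n) * a n)) (Sa≗a (suc n)) ⟨
  - (S 1 a (suc n) - a (suc n) - fromℕ (suc n) * a n)
    ≡⟨ cong -_ (S-local-suc (_≡ 0ℚ) refl ≡0-+ ≡0-* a n (S-fixed⇒0 a Sa≗a n)) ⟩
  0ℚ
    ≡⟨ ℚᵖ.*-zeroʳ (fromℕ (suc n)) ⟨
  fromℕ (suc n) * 0ℚ ∎)
  where
  open ≡-Reasoning
  regroup : ∀ u v → v ≡ - (u - u - v)
  regroup = solve-∀ ℚ-ring

D-0 : ∀ k → D (λ _ → 0ℚ) k ≡ 0ℚ
D-0 zero    = refl
D-0 (suc k) = ℚᵖ.*-zeroʳ (fromℕ (suc k))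

D-- : ∀ a b k → D (λ i → a i - b i) k ≡ D a k - D b k
D-- a b zero    = refl
D-- a b (suc k) = distrib (fromℕ (suc k)) (a k) (b k)
  where
  distrib : ∀ n x y → n * (x - y) ≡ n * x - n * y
  distrib = solve-∀ ℚ-ring

-- Generating function 1 + e^z + ... + e^((n-1)z), equal to (e^(nz) - 1) / (e^z - 1). The convention
-- 0 ^ 0 = 1 matters for the summand j = 0.
powerSum : ℕ → ℕ → ℚ
powerSum n k = Σ< n (λ j → pow j k)

S-powerSum : ∀ n k → S 1 (powerSum n) k ≡ powerSum n k + pow n k - pow 0 k
S-powerSum zero    k = trans (S-const-0 1 k) (cancel (pow 0 k))
  where
  cancel : ∀ x → 0ℚ ≡ 0ℚ + x - x
  cancel = solve-∀ ℚ-ring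
S-powerSum (suc n) k = begin
  S 1 (λ i → powerSum n i + pow n i) k
    ≡⟨ S-+ 1 (powerSum n) (pow n) k ⟩
  S 1 (powerSum n) k + S 1 (pow n) k
    ≡⟨ cong₂ _+_ (S-powerSum n k) (trans (S-pow 1 n k) (cong (λ m → pow m k) (ℕᵖ.+-comm n 1))) ⟩
  (powerSum n k + pow n k - pow 0 k) + pow (suc n) k
    ≡⟨ swap (powerSum n k + pow n k) (pow 0 k) (pow (suc n) k) ⟩
  powerSum (suc n) k + pow (suc n) k - pow 0 k ∎
  where
  open ≡-Reasoning
  swap : ∀ u v w → (u - v) + w ≡ u + w - v
  swap = solve-∀ ℚ-ring

S-B-iterate : ∀ c k → S c B k ≡ B k + D (powerSum c) k
S-B-iterate zero    k = trans (S-zero B k) (trans (sym (ℚᵖ.+-identityʳ (B k))) (cong (_+_ (B k)) (sym (D-0 k))))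
S-B-iterate (suc c) k = begin
  S (suc c) B k
    ≡⟨ cong (λ m → S m B k) (ℕᵖ.+-comm 1 c) ⟩
  S (c ℕ.+ 1) B k
    ≡⟨ S-S c 1 B k ⟨
  S c (S 1 B) k
    ≡⟨ trans (S-cong c S-B k) (S-+ c B (D (pow 0)) k) ⟩
  S c B k + S c (D (pow 0)) k
    ≡⟨ cong₂ _+_ (S-B-iterate c k) (trans (S-D c (pow 0) k) (D-cong (S-pow c 0) k)) ⟩
  B k + D (powerSum c) k + D (pow c) k
    ≡⟨ ℚᵖ.+-assoc (B k) (D (powerSum c) k) (D (pow c) k) ⟩
  B k + (D (powerSum c) k + D (pow c) k)
    ≡⟨ cong (_+_ (B k)) (D-+ (powerSum c) (pow c) k) ⟨
  B k + D (powerSum (suc c)) k ∎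
  where open ≡-Reasoning

-- The exponential generating function of G c is c / (e ^ (c z) - 1) - 1 / (e ^ z - 1).
G : ℕ → ℕ → ℚ
G c k = (pow c (suc k) - 1ℚ) * B̂ (suc k)

-- Multiplying the generating function of `G c` by z gives b(c z) - b(z) with b(z) = z / (e^z - 1).
D-G : ∀ c k → D (G c) k ≡ pow c k * B k - B k
D-G c zero    = refl
D-G c (suc k) = begin
  fromℕ (suc k) * ((pow c (suc k) - 1ℚ) * (B (suc k) * recip (suc k)))
    ≡⟨ regroup (fromℕ (suc k)) (pow c (suc k)) (B (suc k)) (recip (suc k)) ⟩
  (pow c (suc k) * B (suc k) - B (suc k)) * (fromℕ (suc k) * recip (suc k))
    ≡⟨ cong ((pow c (suc k) * B (suc k) - B (suc k)) *_) (recip-inverseʳ k) ⟩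
  (pow c (suc k) * B (suc k) - B (suc k)) * 1ℚ
    ≡⟨ ℚᵖ.*-identityʳ _ ⟩
  pow c (suc k) * B (suc k) - B (suc k) ∎
  where
  open ≡-Reasoning
  regroup : ∀ n x b r → n * ((x - 1ℚ) * (b * r)) ≡ (x * b - b) * (n * r)
  regroup = solve-∀ ℚ-ring

pow-D-pow-0 : ∀ c k → pow c k * D (pow 0) k ≡ fromℕ c * D (pow 0) k
pow-D-pow-0 c zero          = trans (ℚᵖ.*-zeroʳ 1ℚ) (sym (ℚᵖ.*-zeroʳ (fromℕ c)))
pow-D-pow-0 c (suc zero)    = cong (λ m → fromℕ m * 1ℚ) (ℕᵖ.*-identityʳ c)
pow-D-pow-0 c (suc (suc k)) = trans
  (trans (cong (pow c (suc (suc k)) *_) D≡0) (ℚᵖ.*-zeroʳ (pow c (suc (suc k)))))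
  (sym (trans (cong (fromℕ c *_) D≡0) (ℚᵖ.*-zeroʳ (fromℕ c))))
  where
  D≡0 : D (pow 0) (suc (suc k)) ≡ 0ℚ
  D≡0 = ℚᵖ.*-zeroʳ (fromℕ (suc (suc k)))

-- The identity (e^(cz) - 1) G = c - (1 + e^z + ... + e^((c-1)z)). It is checked after
-- multiplication by z, where the known shifts of `B` and of its dilation apply.
S-G : ∀ c k → S c (G c) k - G c k ≡ fromℕ c * pow 0 k - powerSum c k
S-G c = D-injective λ k → begin
  D (λ i → S c (G c) i - G c i) k
    ≡⟨ D-- (S c (G c)) (G c) k ⟩
  D (S c (G c)) k - D (G c) k
    ≡⟨ cong (_- D (G c) k) (trans (sym (S-D c (G c) k)) (S-cong c (D-G c) k)) ⟩
  S c (λ i → pow c i * B i - B i) k - D (G c) k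
    ≡⟨ cong₂ _-_ (S-- c (λ i → pow c i * B i) B k) (D-G c k) ⟩
  S c (λ i → pow c i * B i) k - S c B k - (pow c k * B k - B k)
    ≡⟨ cong₂ (λ u v → u - v - (pow c k * B k - B k))
         (trans (S-dilate c B k) (cong (pow c k *_) (S-B k))) (S-B-iterate c k) ⟩
  pow c k * (B k + D (pow 0) k) - (B k + D (powerSum c) k) - (pow c k * B k - B k)
    ≡⟨ cancel (pow c k) (B k) (D (pow 0) k) (D (powerSum c) k) ⟩
  pow c k * D (pow 0) k - D (powerSum c) k
    ≡⟨ cong (_- D (powerSum c) k) (trans (pow-D-pow-0 c k) (sym (D-* (fromℕ c) (pow 0) k))) ⟩
  D (λ i → fromℕ c * pow 0 i) k - D (powerSum c) k
    ≡⟨ D-- (λ i → fromℕ c * pow 0 i) (powerSum c) k ⟨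
  D (λ i → fromℕ c * pow 0 i - powerSum c i) k ∎
  where
  open ≡-Reasoning
  cancel : ∀ x b d e → x * (b + d) - (b + e) - (x * b - b) ≡ x * d - e
  cancel = solve-∀ ℚ-ring

-- Multiplying the generating function of a by 1 + e ^ z + ⋯ + e ^ ((n - 1) z)
-- gives the first summands.
V : (ℕ → ℚ) → ℕ → ℕ → ℚ
V a n k = Σ< n (λ i → S i a k + powerSum i k)

-- Applying e^z - 1 makes both sums in `V` telescope, to (e^(nz) - 1) A and to `powerSum n` minus n.
-- For `G c` and n = c, `S-G` says that these cancel.
S-V : ∀ a n k → S 1 (V a n) k ≡ V a n k + (S n a k - a k + powerSum n k - fromℕ n * pow 0 k)
S-V a zero    k = trans (S-const-0 1 k)
  (trans (cancel (a k) (pow 0 k)) (cong (λ u → 0ℚ + (u - a k + 0ℚ - 0ℚ * pow 0 k)) (sym (S-zero a k))))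
  where
  cancel : ∀ u v → 0ℚ ≡ 0ℚ + (u - u + 0ℚ - 0ℚ * v)
  cancel = solve-∀ ℚ-ring
S-V a (suc n) k = begin
  S 1 (V a (suc n)) k
    ≡⟨ trans (S-+ 1 (V a n) (λ i → S n a i + powerSum n i) k)
             (cong (_+_ (S 1 (V a n) k)) (S-+ 1 (S n a) (powerSum n) k)) ⟩
  S 1 (V a n) k + (S 1 (S n a) k + S 1 (powerSum n) k)
    ≡⟨ cong₂ _+_ (S-V a n k) (cong₂ _+_ (S-S 1 n a k) (S-powerSum n k)) ⟩
  V a n k + (S n a k - a k + powerSum n k - fromℕ n * pow 0 k)
    + (S (suc n) a k + (powerSum n k + pow n k - pow 0 k))
    ≡⟨ regroup (V a n k) (S n a k) (a k) (powerSum n k) (fromℕ n) (pow 0 k) (S (suc n) a k) (pow n k) ⟩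
  V a (suc n) k + (S (suc n) a k - a k + powerSum (suc n) k - (1ℚ + fromℕ n) * pow 0 k)
    ≡⟨ cong (λ m → V a (suc n) k + (S (suc n) a k - a k + powerSum (suc n) k - m * pow 0 k)) (fromℕ-suc n) ⟨
  V a (suc n) k + (S (suc n) a k - a k + powerSum (suc n) k - fromℕ (suc n) * pow 0 k) ∎
  where
  open ≡-Reasoning
  regroup : ∀ v s a q n z t x →
    v + (s - a + q - n * z) + (t + (q + x - z)) ≡ v + (s + q) + (t - a + (q + x) - (1ℚ + n) * z)
  regroup = solve-∀ ℚ-ring

V-G≡0 : ∀ c k → V (G c) c k ≡ 0ℚ
V-G≡0 c k = S-fixed⇒0 (V (G c) c) fixed (suc k) k ℕᵖ.≤-refl
  where
  cancel : ∀ v x q → v + (x - q + q - x) ≡ v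
  cancel = solve-∀ ℚ-ring
  fixed : S 1 (V (G c) c) ≗ V (G c) c
  fixed i = trans (S-V (G c) c i)
    (trans (cong (λ u → V (G c) c i + (u + powerSum c i - fromℕ c * pow 0 i)) (S-G c i))
           (cancel (V (G c) c i) (fromℕ c * pow 0 i) (powerSum c i)))

-- Sequences of moments of integer weights

IsMoment : (ℕ → ℚ) → Set
IsMoment a = ∃[ ws ] ∀ k → a k ≡ fromℤ (moment ws k)

moment-++ : ∀ us vs k → moment (us ++ vs) k ≡ moment us k ℤ.+ moment vs k
moment-++ []             vs k = sym (ℤᵖ.+-identityˡ _)
moment-++ ((w , x) ∷ us) vs k = trans
  (cong (ℤ._+_ (w ℤ.* + (x ℕ.^ k))) (moment-++ us vs k)) (sym (ℤᵖ.+-assoc (w ℤ.* + (x ℕ.^ k)) _ _))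

isMoment-+ : ∀ {a b} → IsMoment a → IsMoment b → IsMoment (λ k → a k + b k)
isMoment-+ (us , a≡) (vs , b≡) = us ++ vs , λ k →
  trans (cong₂ _+_ (a≡ k) (b≡ k))
    (sym (trans (cong fromℤ (moment-++ us vs k)) (fromℤ-+ (moment us k) (moment vs k))))

scale : ℤ → List (ℤ × ℕ) → List (ℤ × ℕ)
scale z = map λ (w , x) → z ℤ.* w , x

moment-scale : ∀ z ws k → moment (scale z ws) k ≡ z ℤ.* moment ws k
moment-scale z []             k = sym (ℤᵖ.*-zeroʳ z)
moment-scale z ((w , x) ∷ ws) k = trans
  (cong₂ ℤ._+_ (ℤᵖ.*-assoc z w _) (moment-scale z ws k)) (sym (ℤᵖ.*-distribˡ-+ z _ _))

isMoment-* : ∀ z {a} → IsMoment a → IsMoment (λ k → fromℤ z * a k)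
isMoment-* z (ws , a≡) = scale z ws , λ k →
  trans (cong (fromℤ z *_) (a≡ k))
    (sym (trans (cong fromℤ (moment-scale z ws k)) (fromℤ-* z (moment ws k))))

isMoment-0 : IsMoment (λ _ → 0ℚ)
isMoment-0 = [] , λ _ → refl

isMoment-pow : ∀ x → IsMoment (pow x)
isMoment-pow x = (+ 1 , x) ∷ [] , λ k →
  cong fromℤ (sym (trans (ℤᵖ.+-identityʳ _) (ℤᵖ.*-identityˡ (+ (x ℕ.^ k)))))

isMoment-cong : ∀ {a b} → a ≗ b → IsMoment a → IsMoment b
isMoment-cong a≗b (ws , a≡) = ws , λ k → trans (sym (a≗b k)) (a≡ k)

isMoment-- : ∀ {a b} → IsMoment a → IsMoment b → IsMoment (λ k → a k - b k)
isMoment-- {a} {b} ma mb = isMoment-cong (λ k → minus (a k) (b k)) (isMoment-+ ma (isMoment-* ℤ.-1ℤ mb))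
  where
  minus : ∀ u v → u + - 1ℚ * v ≡ u - v
  minus = solve-∀ ℚ-ring

isMoment-Σ : ∀ n {f : ℕ → ℕ → ℚ} → (∀ i → IsMoment (f i)) → IsMoment (λ k → Σ< n (λ i → f i k))
isMoment-Σ zero    mf = isMoment-0
isMoment-Σ (suc n) mf = isMoment-+ (isMoment-Σ n mf) (mf n)

-- Each node x moves to x + y and keeps its weight.
isMoment-S : ∀ y {a} → IsMoment a → IsMoment (S y a)
isMoment-S y (ws , a≡) = isMoment-cong (λ k → S-cong y (sym ∘ a≡) k) (go ws)
  where
  go : ∀ ws → IsMoment (S y (λ k → fromℤ (moment ws k)))
  go []             = isMoment-cong (sym ∘ S-const-0 y) isMoment-0
  go ((w , x) ∷ ws) = isMoment-cong
    (λ k → sym (trans (S-cong y (λ i → trans (fromℤ-+ (w ℤ.* + (x ℕ.^ i)) (moment ws i))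
                                             (cong (_+ fromℤ (moment ws i)) (fromℤ-* w (+ (x ℕ.^ i))))) k)
               (trans (S-+ y (λ i → fromℤ w * pow x i) (λ i → fromℤ (moment ws i)) k)
                      (cong (_+ S y (λ i → fromℤ (moment ws i)) k)
                            (trans (S-* y (fromℤ w) (pow x) k) (cong (fromℤ w *_) (S-pow y x k)))))))
    (isMoment-+ (isMoment-* w (isMoment-pow (x ℕ.+ y))) (go ws))

-- By V-G≡0, c * G c k is the sum of G c k - S i (G c) k - powerSum i k over
-- i < c, and S i - 1 lowers degrees: each multiplication by c extends the range
-- of k on which G c is an integer combination of powers.
G-moment : ∀ c N → ∃[ ws ] ∀ k → k < N → pow c N * G c k ≡ fromℤ (moment ws k)
G-moment c N with approximant N
  where
  approximant : ∀ N → ∃[ a ] IsMoment a × (∀ k → k < N → pow c N * G c k ≡ a k)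
  approximant zero    = (λ _ → 0ℚ) , isMoment-0 , λ _ ()
  approximant (suc N) with approximant N
  ... | a , ma , eq = (λ k → Σ< c (λ i → f i k)) , isMoment-Σ c mf , agrees
    where
    f : ℕ → ℕ → ℚ
    f i k = a k - S i a k - pow c N * powerSum i k

    mf : ∀ i → IsMoment (f i)
    mf i = isMoment-- (isMoment-- ma (isMoment-S i ma)) (isMoment-* (+ (c ℕ.^ N)) (isMoment-Σ i isMoment-pow))

    b : ℕ → ℚ
    b k = pow c N * G c k

    -- The value of S i - 1 at k depends only on indices j < k ≤ N, where a and b already agree.
    -- This gains the index k = N.
    local : ∀ i k → k < suc N → a k - S i a k ≡ b k - S i b k
    local i k (s≤s k≤N) = begin
      a k - S i a k
        ≡⟨ regroup (a k) (S i a k) (b k) (S i b k) ⟩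
      (b k - S i b k) + ((S i b k - S i a k) - (b k - a k))
        ≡⟨ cong (λ u → b k - S i b k + (u - (b k - a k))) (S-- i b a k) ⟨
      (b k - S i b k) + (S i (λ j → b j - a j) k - (b k - a k))
        ≡⟨ cong (_+_ (b k - S i b k)) (S-local-0 i (λ j → b j - a j) k
             λ j j<k → trans (cong (_- a j) (eq j (ℕᵖ.<-≤-trans j<k k≤N))) (ℚᵖ.+-inverseʳ (a j))) ⟩
      (b k - S i b k) + 0ℚ
        ≡⟨ ℚᵖ.+-identityʳ _ ⟩
      b k - S i b k ∎
      where
      open ≡-Reasoning
      regroup : ∀ a sa b sb → a - sa ≡ (b - sb) + ((sb - sa) - (b - a))
      regroup = solve-∀ ℚ-ring

    -- Stated for every m to allow induction; the term with `V` disappears at m = c.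
    sum-f : ∀ m k → k < suc N → Σ< m (λ i → f i k) ≡ fromℕ m * b k - pow c N * V (G c) m k
    sum-f zero    k k≤N = vanish (b k) (pow c N)
      where
      vanish : ∀ b x → 0ℚ ≡ 0ℚ * b - x * 0ℚ
      vanish = solve-∀ ℚ-ring
    sum-f (suc m) k k≤N = begin
      Σ< m (λ i → f i k) + (a k - S m a k - pow c N * powerSum m k)
        ≡⟨ cong₂ (λ u v → u + (v - pow c N * powerSum m k)) (sum-f m k k≤N) (local m k k≤N) ⟩
      fromℕ m * b k - pow c N * V (G c) m k + (b k - S m b k - pow c N * powerSum m k)
        ≡⟨ cong (λ u → fromℕ m * b k - pow c N * V (G c) m k + (b k - u - pow c N * powerSum m k)) (S-* m (pow c N) (G c) k) ⟩
      fromℕ m * b k - pow c N * V (G c) m k + (b k - pow c N * S m (G c) k - pow c N * powerSum m k)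
        ≡⟨ regroup (fromℕ m) (b k) (pow c N) (V (G c) m k) (S m (G c) k) (powerSum m k) ⟩
      (1ℚ + fromℕ m) * b k - pow c N * V (G c) (suc m) k
        ≡⟨ cong (λ u → u * b k - pow c N * V (G c) (suc m) k) (fromℕ-suc m) ⟨
      fromℕ (suc m) * b k - pow c N * V (G c) (suc m) k ∎
      where
      open ≡-Reasoning
      regroup : ∀ m b x v s q → m * b - x * v + (b - x * s - x * q) ≡ (1ℚ + m) * b - x * (v + (s + q))
      regroup = solve-∀ ℚ-ring

    agrees : ∀ k → k < suc N → pow c (suc N) * G c k ≡ Σ< c (λ i → f i k)
    agrees k k≤N = begin
      pow c (suc N) * G c k
        ≡⟨ cong (_* G c k) (fromℕ-* c (c ℕ.^ N)) ⟩
      fromℕ c * pow c N * G c k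
        ≡⟨ insert (fromℕ c) (pow c N) (G c k) ⟩
      fromℕ c * b k - pow c N * 0ℚ
        ≡⟨ cong (λ u → fromℕ c * b k - pow c N * u) (V-G≡0 c k) ⟨
      fromℕ c * b k - pow c N * V (G c) c k
        ≡⟨ sum-f c k k≤N ⟨
      Σ< c (λ i → f i k) ∎
      where
      open ≡-Reasoning
      insert : ∀ c x g → c * x * g ≡ c * (x * g) - x * 0ℚ
      insert = solve-∀ ℚ-ring
... | a , (ws , a≡) , eq = ws , λ k k<N → trans (eq k k<N) (a≡ k)

-- Divisibility in ℤ₍ₚ₎

↧-*-cancel : ∀ q → fromℤ (↧ q) * q ≡ fromℤ (↥ q)
↧-*-cancel q@record{} = ℚᵖ.toℚᵘ-injective (begin
  toℚᵘ (fromℤ (↧ q) * q)           ≈⟨ ℚᵖ.toℚᵘ-homo-* (fromℤ (↧ q)) q ⟩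
  toℚᵘ (fromℤ (↧ q)) ℚᵘ.* toℚᵘ q   ≈⟨ ℚᵘᵖ.*-congʳ {toℚᵘ q} (toℚᵘ-fromℤ (↧ q)) ⟩
  mkℚᵘ (↧ q) 0 ℚᵘ.* toℚᵘ q         ≈⟨ *≡* (trans (ℤᵖ.*-identityʳ _) (trans (ℤᵖ.*-comm (↧ q) (↥ q)) (cong (λ d → ↥ q ℤ.* + d) (sym (ℕᵖ.+-identityʳ _))))) ⟩
  mkℚᵘ (↥ q) 0                     ≈⟨ toℚᵘ-fromℤ (↥ q) ⟨
  toℚᵘ (fromℤ (↥ q))               ∎)
  where open ℚᵘᵖ.≃-Reasoning

fromℤ-*-cross : ∀ a b q → fromℤ a * q ≡ fromℤ b → a ℤ.* ↥ q ≡ b ℤ.* ↧ q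
fromℤ-*-cross a b q eq = fromℤ-injective (begin
  fromℤ (a ℤ.* ↥ q)             ≡⟨ fromℤ-* a (↥ q) ⟩
  fromℤ a * fromℤ (↥ q)         ≡⟨ cong (fromℤ a *_) (↧-*-cancel q) ⟨
  fromℤ a * (fromℤ (↧ q) * q)   ≡⟨ swap (fromℤ a) (fromℤ (↧ q)) q ⟩
  fromℤ a * q * fromℤ (↧ q)     ≡⟨ cong (_* fromℤ (↧ q)) eq ⟩
  fromℤ b * fromℤ (↧ q)         ≡⟨ fromℤ-* b (↧ q) ⟨
  fromℤ (b ℤ.* ↧ q)             ∎)
  where
  open ≡-Reasoning
  swap : ∀ a d q → a * (d * q) ≡ a * q * d
  swap = solve-∀ ℚ-ring

module Local {m : ℕ} (p-prime : Prime (suc m)) where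

  p : ℕ
  p = suc m

  infix 4 _∣ₚ_

  -- p ^ n divides q in the local ring ℤ₍ₚ₎.
  record _∣ₚ_ (n : ℕ) (q : ℚ) : Set where
    constructor local
    field
      v u      : ℤ
      p∤v      : ¬ + p ∣ v
      v*q≡pⁿ*u : fromℤ v * q ≡ fromℤ ((+ p) ℤ.^ n ℤ.* u)

  p∤suc : ∀ {k} → suc k < p → ¬ + p ∣ + suc k
  p∤suc k<p p∣k = ℕᵖ.<⇒≱ k<p (ℕ∣.∣⇒≤ (∣⇒∣ᵤ p∣k))

  p∤1 : ¬ + p ∣ 1ℤ
  p∤1 = p∤suc (ℕ.nonTrivial⇒n>1 p {{prime⇒nonTrivial p-prime}})

  fromℤ-∣ₚ : ∀ {n} z → (+ p) ℤ.^ n ∣ z → n ∣ₚ fromℤ z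
  fromℤ-∣ₚ {n} z (divides u refl) = local 1ℤ u p∤1
    (trans (ℚᵖ.*-identityˡ (fromℤ z)) (cong fromℤ (ℤᵖ.*-comm u _)))

  ∣ₚ-fromℤ : ∀ {n} z → n ∣ₚ fromℤ z → (+ p) ℤ.^ n ∣ z
  ∣ₚ-fromℤ {n} z (local v u p∤v eq) = ^-∣-cancelˡ p-prime n v p∤v
    (divides u (trans (fromℤ-injective (trans (fromℤ-* v z) eq)) (ℤᵖ.*-comm _ u)))

  fromℤ-∣ₚ₁ : ∀ z → + p ∣ z → 1 ∣ₚ fromℤ z
  fromℤ-∣ₚ₁ z p∣z = fromℤ-∣ₚ {1} z (subst (_∣ z) (sym (ℤᵖ.*-identityʳ (+ p))) p∣z)

  ∣ₚ₁-fromℤ : ∀ z → 1 ∣ₚ fromℤ z → + p ∣ z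
  ∣ₚ₁-fromℤ z p∣z = subst (_∣ z) (ℤᵖ.*-identityʳ (+ p)) (∣ₚ-fromℤ z p∣z)

  ∣ₚ-0 : ∀ {n} → n ∣ₚ 0ℚ
  ∣ₚ-0 {n} = fromℤ-∣ₚ {n} 0ℤ (divides 0ℤ refl)

  ∣ₚ-+ : ∀ {n q r} → n ∣ₚ q → n ∣ₚ r → n ∣ₚ q + r
  ∣ₚ-+ {n} {q} {r} (local v u p∤v eq) (local v′ u′ p∤v′ eq′) =
    local (v ℤ.* v′) (v′ ℤ.* u ℤ.+ v ℤ.* u′) (∤-* p-prime p∤v p∤v′) (begin
    fromℤ (v ℤ.* v′) * (q + r)
      ≡⟨ cong (_* (q + r)) (fromℤ-* v v′) ⟩
    fromℤ v * fromℤ v′ * (q + r)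
      ≡⟨ distrib (fromℤ v) (fromℤ v′) q r ⟩
    fromℤ v′ * (fromℤ v * q) + fromℤ v * (fromℤ v′ * r)
      ≡⟨ cong₂ (λ x y → fromℤ v′ * x + fromℤ v * y) eq eq′ ⟩
    fromℤ v′ * fromℤ (P ℤ.* u) + fromℤ v * fromℤ (P ℤ.* u′)
      ≡⟨ cong₂ _+_ (fromℤ-* v′ (P ℤ.* u)) (fromℤ-* v (P ℤ.* u′)) ⟨
    fromℤ (v′ ℤ.* (P ℤ.* u)) + fromℤ (v ℤ.* (P ℤ.* u′))
      ≡⟨ fromℤ-+ (v′ ℤ.* (P ℤ.* u)) (v ℤ.* (P ℤ.* u′)) ⟨
    fromℤ (v′ ℤ.* (P ℤ.* u) ℤ.+ v ℤ.* (P ℤ.* u′))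
      ≡⟨ cong fromℤ (factor v v′ P u u′) ⟩
    fromℤ (P ℤ.* (v′ ℤ.* u ℤ.+ v ℤ.* u′)) ∎)
    where
    open ≡-Reasoning
    P = (+ p) ℤ.^ n
    distrib : ∀ v w q r → v * w * (q + r) ≡ w * (v * q) + v * (w * r)
    distrib = solve-∀ ℚ-ring
    factor : ∀ v w P x y → w ℤ.* (P ℤ.* x) ℤ.+ v ℤ.* (P ℤ.* y) ≡ P ℤ.* (w ℤ.* x ℤ.+ v ℤ.* y)
    factor = ℤ-Solver.solve-∀

  ∣ₚ-* : ∀ {n q} z → n ∣ₚ q → n ∣ₚ fromℤ z * q
  ∣ₚ-* {n} {q} z (local v u p∤v eq) = local v (z ℤ.* u) p∤v (begin
    fromℤ v * (fromℤ z * q)             ≡⟨ swap (fromℤ v) (fromℤ z) q ⟩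
    fromℤ z * (fromℤ v * q)             ≡⟨ cong (fromℤ z *_) eq ⟩
    fromℤ z * fromℤ (P ℤ.* u)           ≡⟨ fromℤ-* z (P ℤ.* u) ⟨
    fromℤ (z ℤ.* (P ℤ.* u))             ≡⟨ cong fromℤ (swap′ z P u) ⟩
    fromℤ (P ℤ.* (z ℤ.* u))             ∎)
    where
    open ≡-Reasoning
    P = (+ p) ℤ.^ n
    swap : ∀ x y z → x * (y * z) ≡ y * (x * z)
    swap = solve-∀ ℚ-ring
    swap′ : ∀ x y z → x ℤ.* (y ℤ.* z) ≡ y ℤ.* (x ℤ.* z)
    swap′ = ℤ-Solver.solve-∀

  ∣ₚ-- : ∀ {n q r} → n ∣ₚ q → n ∣ₚ r → n ∣ₚ q - r
  ∣ₚ-- {n} {q} {r} n∣q n∣r = subst (n ∣ₚ_) (minus q r) (∣ₚ-+ n∣q (∣ₚ-* ℤ.-1ℤ n∣r))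
    where
    minus : ∀ q r → q + - 1ℚ * r ≡ q - r
    minus = solve-∀ ℚ-ring

  ∣ₚ-*-cancel : ∀ {n q} w → ¬ + p ∣ w → n ∣ₚ fromℤ w * q → n ∣ₚ q
  ∣ₚ-*-cancel {n} {q} w p∤w (local v u p∤v eq) = local (v ℤ.* w) u (∤-* p-prime p∤v p∤w)
    (trans (cong (_* q) (fromℤ-* v w)) (trans (ℚᵖ.*-assoc (fromℤ v) (fromℤ w) q) eq))

  ∣ₚ-p* : ∀ {n q} → n ∣ₚ q → suc n ∣ₚ fromℕ p * q
  ∣ₚ-p* {n} {q} (local v u p∤v eq) = local v u p∤v (begin
    fromℤ v * (fromℕ p * q)       ≡⟨ swap (fromℤ v) (fromℕ p) q ⟩
    fromℕ p * (fromℤ v * q)       ≡⟨ cong (fromℕ p *_) eq ⟩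
    fromℕ p * fromℤ (P ℤ.* u)     ≡⟨ fromℤ-* (+ p) (P ℤ.* u) ⟨
    fromℤ (+ p ℤ.* (P ℤ.* u))     ≡⟨ cong fromℤ (ℤᵖ.*-assoc (+ p) P u) ⟨
    fromℤ (+ p ℤ.* P ℤ.* u)       ∎)
    where
    open ≡-Reasoning
    P = (+ p) ℤ.^ n
    swap : ∀ x y z → x * (y * z) ≡ y * (x * z)
    swap = solve-∀ ℚ-ring

  ∣ₚ-p*-cancel : ∀ {n q} → suc n ∣ₚ fromℕ p * q → n ∣ₚ q
  ∣ₚ-p*-cancel {n} {q} (local v u p∤v eq) = local v u p∤v (fromℕ-suc-cancel m (begin
    fromℕ p * (fromℤ v * q)       ≡⟨ swap (fromℕ p) (fromℤ v) q ⟩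
    fromℤ v * (fromℕ p * q)       ≡⟨ eq ⟩
    fromℤ (+ p ℤ.* P ℤ.* u)       ≡⟨ cong fromℤ (ℤᵖ.*-assoc (+ p) P u) ⟩
    fromℤ (+ p ℤ.* (P ℤ.* u))     ≡⟨ fromℤ-* (+ p) (P ℤ.* u) ⟩
    fromℕ p * fromℤ (P ℤ.* u)     ∎))
    where
    open ≡-Reasoning
    P = (+ p) ℤ.^ n
    swap : ∀ x y z → x * (y * z) ≡ y * (x * z)
    swap = solve-∀ ℚ-ring

  ∣ₚ⇒∣ℚ : ∀ {n q} → n ∣ₚ q → p ℕ.^ n ∣ℚ q
  ∣ₚ⇒∣ℚ {n} {q} (local v u p∤v eq) = ∣⇒∣ᵤ (subst (_∣ ↥ q) (sym (pos-^ p n))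
    (^-∣-cancelˡ p-prime n v p∤v (divides (u ℤ.* ↧ q) (trans (fromℤ-*-cross v ((+ p) ℤ.^ n ℤ.* u) q eq) (swap ((+ p) ℤ.^ n) u (↧ q))))))
    where
    swap : ∀ P u d → P ℤ.* u ℤ.* d ≡ u ℤ.* d ℤ.* P
    swap = ℤ-Solver.solve-∀

  -- Not for n = 0, where the left-hand side allows p in the denominator of q.
  ∣ℚ⇒∣ₚ : ∀ {n} q → p ℕ.^ suc n ∣ℚ q → suc n ∣ₚ q
  ∣ℚ⇒∣ₚ {n} q@record{isCoprime = coprime} pⁿ∣↥q
    with subst (_∣ ↥ q) (pos-^ p (suc n)) (∣ᵤ⇒∣ pⁿ∣↥q)
  ... | divides u ↥q≡ = local (↧ q) u p∤↧q
    (trans (↧-*-cancel q) (cong fromℤ (trans ↥q≡ (ℤᵖ.*-comm u _))))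
    where
    p∤↧q : ¬ + p ∣ ↧ q
    p∤↧q p∣↧q = contradiction
      (Coprimality.recompute coprime (ℕ∣.∣-trans (ℕ∣.m∣m*n (p ℕ.^ n)) pⁿ∣↥q , ∣⇒∣ᵤ p∣↧q))
      (ℕ.nonTrivial⇒≢1 {{prime⇒nonTrivial p-prime}})

  ∣ₚ-recip : ∀ k x → suc k < p → 0 ∣ₚ fromℕ x * recip (suc k)
  ∣ₚ-recip k x k<p = local (+ suc k) (+ x) (p∤suc k<p) (begin
    fromℕ (suc k) * (fromℕ x * recip (suc k))   ≡⟨ swap (fromℕ (suc k)) (fromℕ x) (recip (suc k)) ⟩
    fromℕ x * (fromℕ (suc k) * recip (suc k))   ≡⟨ cong (fromℕ x *_) (recip-inverseʳ k) ⟩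
    fromℕ x * 1ℚ                                ≡⟨ ℚᵖ.*-identityʳ (fromℕ x) ⟩
    fromℕ x                                     ≡⟨ cong fromℤ (ℤᵖ.*-identityˡ (+ x)) ⟨
    fromℤ (1ℤ ℤ.* + x)                          ∎)
    where
    open ≡-Reasoning
    swap : ∀ x y z → x * (y * z) ≡ y * (x * z)
    swap = solve-∀ ℚ-ring

  -- With b k = x ^ (k + 1) / (k + 1), which is p-integral for k < p - 1, the
  -- sequence x ^ k is 0 ^ k + D b, so that (x + 1) ^ p - x ^ p - 1 is p times
  -- S 1 b (p - 1) - b (p - 1).
  freshman : ∀ x → 1 ∣ₚ pow (suc x) p - pow x p - 1ℚ
  freshman x = subst (1 ∣ₚ_) (sym difference)
    (∣ₚ-p* (S-local (0 ∣ₚ_) ∣ₚ-0 ∣ₚ-+ (λ n → ∣ₚ-* (+ n)) 1 b m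
      (λ j j<m → ∣ₚ-recip j (x ℕ.^ suc j) (s≤s j<m))))
    where
    open ≡-Reasoning
    b : ℕ → ℚ
    b k = pow x (suc k) * recip (suc k)
    split : ∀ k → pow x k ≡ pow 0 k + D b k
    split zero    = refl
    split (suc k) = begin
      pow x (suc k)
        ≡⟨ ℚᵖ.*-identityʳ (pow x (suc k)) ⟨
      pow x (suc k) * 1ℚ
        ≡⟨ cong (pow x (suc k) *_) (recip-inverseʳ k) ⟨
      pow x (suc k) * (fromℕ (suc k) * recip (suc k))
        ≡⟨ swap (pow x (suc k)) (fromℕ (suc k)) (recip (suc k)) ⟩
      0ℚ + fromℕ (suc k) * b k ∎
      where
      swap : ∀ x y z → x * (y * z) ≡ 0ℚ + y * (x * z)
      swap = solve-∀ ℚ-ring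
    difference : pow (suc x) p - pow x p - 1ℚ ≡ fromℕ p * (S 1 b m - b m)
    difference = begin
      pow (suc x) p - pow x p - 1ℚ
        ≡⟨ cong (λ y → pow y p - pow x p - 1ℚ) (ℕᵖ.+-comm 1 x) ⟩
      pow (x ℕ.+ 1) p - pow x p - 1ℚ
        ≡⟨ cong₂ (λ u v → u - v - 1ℚ) (sym (S-pow 1 x p)) (split p) ⟩
      S 1 (pow x) p - (0ℚ + fromℕ p * b m) - 1ℚ
        ≡⟨ cong (λ u → u - (0ℚ + fromℕ p * b m) - 1ℚ) (trans (S-cong 1 split p) (S-+ 1 (pow 0) (D b) p)) ⟩
      S 1 (pow 0) p + S 1 (D b) p - (0ℚ + fromℕ p * b m) - 1ℚ
        ≡⟨ cong₂ (λ u v → u + v - (0ℚ + fromℕ p * b m) - 1ℚ)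
             (trans (S-pow 1 0 p) (cong fromℕ (ℕᵖ.^-zeroˡ p))) (S-D 1 b p) ⟩
      1ℚ + fromℕ p * S 1 b m - (0ℚ + fromℕ p * b m) - 1ℚ
        ≡⟨ cancel (fromℕ p) (S 1 b m) (b m) ⟩
      fromℕ p * (S 1 b m - b m) ∎
      where
      cancel : ∀ n s t → 1ℚ + n * s - (0ℚ + n * t) - 1ℚ ≡ n * (s - t)
      cancel = solve-∀ ℚ-ring

  fermat-little : ∀ x → 1 ∣ₚ pow x p - fromℕ x
  fermat-little zero    = ∣ₚ-0 {1}
  fermat-little (suc x) = subst (1 ∣ₚ_)
    (trans (telescope (pow (suc x) p) (pow x p) (fromℕ x)) (cong (_-_ (pow (suc x) p)) (sym (fromℕ-suc x))))
    (∣ₚ-+ (freshman x) (fermat-little x))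
    where
    telescope : ∀ u v w → (u - v - 1ℚ) + (v - w) ≡ u - (1ℚ + w)
    telescope = solve-∀ ℚ-ring

  fermat : ∀ x → + p ∣ + x ⊎ + p ∣ (+ x) ℤ.^ m ℤ.- 1ℤ
  fermat x = euclid p-prime (+ x) ((+ x) ℤ.^ m ℤ.- 1ℤ)
    (subst (+ p ∣_) factor (∣ₚ₁-fromℤ (+ (x ℕ.^ p) ℤ.- + x)
      (subst (1 ∣ₚ_) (sym (fromℤ-- (+ (x ℕ.^ p)) (+ x))) (fermat-little x))))
    where
    distrib : ∀ x y → x ℤ.* y ℤ.- x ≡ x ℤ.* (y ℤ.- 1ℤ)
    distrib = ℤ-Solver.solve-∀
    factor : + (x ℕ.^ p) ℤ.- + x ≡ + x ℤ.* ((+ x) ℤ.^ m ℤ.- 1ℤ)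
    factor = trans (cong (ℤ._- + x) (pos-^ x p)) (distrib (+ x) ((+ x) ℤ.^ m))

  -- Summing (j + 1)^(k+1) - j^(k+1) over j < p telescopes to p^(k+1). Expanded by `S-local-suc` it
  -- is (k + 1) * powerSum p k plus a combination of lower power sums, and k + 1 < p can be
  -- cancelled. The bound n drives the strong induction.
  ∣ₚ-powerSum : ∀ n k → k < n → suc k < p → 1 ∣ₚ powerSum p k
  ∣ₚ-powerSum (suc n) k (s≤s k≤n) k<p-1 = ∣ₚ-*-cancel (+ suc k) (p∤suc k<p-1) (subst (1 ∣ₚ_)
    (trans (cong (λ u → 0ℚ + pow p (suc k) - (u - powerSum p (suc k) - fromℕ (suc k) * powerSum p k)) (S-powerSum p (suc k)))
           (cancel (powerSum p (suc k)) (pow p (suc k)) (fromℕ (suc k) * powerSum p k)))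
    (∣ₚ-- {q = 0ℚ + pow p (suc k)}
      (subst (1 ∣ₚ_) (sym (ℚᵖ.+-identityˡ _)) (fromℤ-∣ₚ₁ (+ (p ℕ.^ suc k))
        (subst (+ p ∣_) (sym (ℤᵖ.pos-* p (p ℕ.^ k))) (∣m⇒∣m*n (+ (p ℕ.^ k)) ∣-refl))))
      (S-local-suc (1 ∣ₚ_) (∣ₚ-0 {1}) ∣ₚ-+ (λ n → ∣ₚ-* (+ n)) (powerSum p) k
        (λ j j<k → ∣ₚ-powerSum n j (ℕᵖ.<-≤-trans j<k k≤n) (ℕᵖ.<-trans (s≤s j<k) k<p-1)))))
    where
    cancel : ∀ s x y → 0ℚ + x - ((s + x - 0ℚ) - s - y) ≡ y
    cancel = solve-∀ ℚ-ring

  -- If c ^ l ≡ 1 for all c prime to p, then 0 ^ l + ⋯ + (p - 1) ^ l ≡ p - 1.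
  nontrivial-power : ∀ e → suc e < m → ∃[ c ] (¬ + p ∣ + c) × (¬ + p ∣ + (c ℕ.^ suc e) ℤ.- 1ℤ)
  nontrivial-power e l<m
    with ℕᵖ.anyUpTo? (λ c → ¬? (+ p ∣? + c) ×-dec ¬? (+ p ∣? + (c ℕ.^ suc e) ℤ.- 1ℤ)) p
  ... | yes (c , _ , found) = c , found
  ... | no  none            = contradiction (∣ₚ₁-fromℤ (+ m) 1∣ₚm) (p∤m m refl)
    where
    all-trivial : ∀ c → suc c < p → 1 ∣ₚ pow (suc c) (suc e) - 1ℚ
    all-trivial c c<p = subst (1 ∣ₚ_) (fromℤ-- (+ (suc c ℕ.^ suc e)) 1ℤ)
      (fromℤ-∣ₚ₁ (+ (suc c ℕ.^ suc e) ℤ.- 1ℤ) (decidable-stable (+ p ∣? (+ (suc c ℕ.^ suc e) ℤ.- 1ℤ))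
        λ p∤c^l-1 → none (suc c , c<p , p∤suc c<p , p∤c^l-1)))
    -- The summand 0 ^ l is 0 as l > 0, so n + 1 summands count only n ones.
    sum : ∀ n → n < p → 1 ∣ₚ powerSum (suc n) (suc e) - fromℕ n
    sum zero    n<p = ∣ₚ-0 {1}
    sum (suc n) n<p = subst (1 ∣ₚ_)
      (trans (regroup (powerSum (suc n) (suc e)) (fromℕ n) (pow (suc n) (suc e)))
             (cong (_-_ (powerSum (suc (suc n)) (suc e))) (sym (fromℕ-suc n))))
      (∣ₚ-+ (sum n (ℕᵖ.<-trans (ℕᵖ.n<1+n n) n<p)) (all-trivial n n<p))
      where
      regroup : ∀ s n x → (s - n) + (x - 1ℚ) ≡ (s + x) - (1ℚ + n)
      regroup = solve-∀ ℚ-ring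
    1∣ₚm : 1 ∣ₚ fromℕ m
    1∣ₚm = subst (1 ∣ₚ_) (cancel (powerSum p (suc e)) (fromℕ m))
      (∣ₚ-- (∣ₚ-powerSum (suc (suc e)) (suc e) ℕᵖ.≤-refl (s≤s l<m)) (sum m ℕᵖ.≤-refl))
      where
      cancel : ∀ s n → s - (s - n) ≡ n
      cancel = solve-∀ ℚ-ring
    p∤m : ∀ n → n ≡ m → ¬ + p ∣ + n
    p∤m zero    refl _ = contradiction l<m λ ()
    p∤m (suc n) refl   = p∤suc ℕᵖ.≤-refl

-- The p-adic zeta function

-- The number n is not coprime to itself. For n = p this crude bound already turns l < φ(p) into l <
-- p - 1.
φ<n : ∀ n → 1 < n → φ n < n
φ<n n@(suc n-1) 1<n = subst (φ n <_) (length-applyUpTo suc n)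
  (filter-notAll (λ k → coprime? k n) (applyUpTo suc n)
    (lose (∈-applyUpTo⁺ suc ℕᵖ.≤-refl) λ n⊥n → ℕᵖ.<⇒≢ 1<n (sym (n⊥n (ℕ∣.∣-refl , ℕ∣.∣-refl)))))

^-monoʳ-∣ : ∀ p {m n} → m ≤ n → p ℕ.^ m ℕ∣.∣ p ℕ.^ n
^-monoʳ-∣ p {n = n} z≤n       = ℕ∣.1∣ (p ℕ.^ n)
^-monoʳ-∣ p         (s≤s m≤n) = ℕ∣.*-monoʳ-∣ p (^-monoʳ-∣ p m≤n)

approx-coherent : ∀ {p} (x : ℤₚ p) n k → + (p ℕ.^ n) ∣ approx x (k ℕ.+ n) ℤ.- approx x n
approx-coherent {p} x n zero    = divides 0ℤ (ℤᵖ.+-inverseʳ (approx x n))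
approx-coherent {p} x n (suc k) = subst (+ (p ℕ.^ n) ∣_)
  (telescope (approx x (suc (k ℕ.+ n))) (approx x (k ℕ.+ n)) (approx x n))
  (∣m∣n⇒∣m+n
    (∣ᵤ⇒∣ {i = approx x (suc (k ℕ.+ n)) ℤ.- approx x (k ℕ.+ n)}
      (ℕ∣.∣-trans (^-monoʳ-∣ p (ℕᵖ.m≤n+m n k)) (coherent x (k ℕ.+ n))))
    (approx-coherent x n k))
  where
  telescope : ∀ a b c → (a ℤ.- b) ℤ.+ (b ℤ.- c) ≡ a ℤ.- c
  telescope = ℤ-Solver.solve-∀

approx-coherent-≤ : ∀ {p} (x : ℤₚ p) {n k} → n ≤ k → + (p ℕ.^ n) ∣ approx x k ℤ.- approx x n
approx-coherent-≤ {p} x {n} {k} n≤k =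
  subst (λ j → + (p ℕ.^ n) ∣ approx x j ℤ.- approx x n) (ℕᵖ.m∸n+n≡m n≤k) (approx-coherent x n (k ∸ n))

module Zeta {m e : ℕ} (irregular : (suc m , suc e) ∈ Ψ-irr 1) where

  open IrregularPair irregular renaming (prime to p-prime)
  open Local p-prime

  l : ℕ
  l = suc e

  l<m : l < m
  l<m = ℕᵖ.<-≤-trans l<φ (ℕᵖ.≤-pred (subst (φ (p ℕ.^ 1) <_) (ℕᵖ.*-identityʳ p) (φ<n (p ℕ.^ 1)
    (subst (1 <_) (sym (ℕᵖ.*-identityʳ p)) (ℕ.nonTrivial⇒n>1 p {{prime⇒nonTrivial p-prime}})))))

  1∣ₚB̂l : 1 ∣ₚ B̂ l
  1∣ₚB̂l = ∣ℚ⇒∣ₚ (B̂ l) p^n∣B̂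

  -- l = 2 is excluded by B̂ 2 = 1/12.
  2≤e : 2 ≤ e
  2≤e = go e refl
    where
    go : ∀ k → k ≡ e → 2 ≤ k
    go zero          refl = contradiction 2≤l λ { (s≤s ()) }
    go (suc zero)    refl = contradiction
      (ℕ∣.∣1⇒≡1 (subst (ℕ∣._∣ 1) (ℕᵖ.*-identityʳ p) p^n∣B̂))
      (ℕ.nonTrivial⇒≢1 {{prime⇒nonTrivial p-prime}})
    go (suc (suc k)) _    = s≤s (s≤s z≤n)

  instance
    m≢0 : ℕ.NonZero m
    m≢0 = ℕ.>-nonZero (ℕᵖ.≤-<-trans z≤n l<m)

  module _ {Δ : ℕ} (isΔ : IsΔ p l Δ) (Δ≢0 : Δ ≢ 0)
    (c : ℕ) (p∤c : ¬ + p ∣ + c) (p∤c^l-1 : ¬ + p ∣ + (c ℕ.^ l) ℤ.- 1ℤ) where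

    p∤c^ : ∀ n → ¬ + p ∣ + (c ℕ.^ n)
    p∤c^ n = ∤-^ p-prime n p∤c ∘ subst (+ p ∣_) (pos-^ c n)

    p∣c^m-1 : + p ∣ + (c ℕ.^ m) ℤ.- 1ℤ
    p∣c^m-1 = [ (λ p∣c → contradiction p∣c p∤c) , subst (λ x → + p ∣ x ℤ.- 1ℤ) (sym (pos-^ c m)) ]′ (fermat c)

    p∤c^[l+m]-1 : ¬ + p ∣ + (c ℕ.^ (l ℕ.+ m)) ℤ.- 1ℤ
    p∤c^[l+m]-1 p∣ = p∤c^l-1 (∣m+n∣n⇒∣m (subst (+ p ∣_) split p∣) (∣n⇒∣m*n (+ (c ℕ.^ l)) p∣c^m-1))
      where
      expand : ∀ x y → x ℤ.* y ℤ.- 1ℤ ≡ (x ℤ.- 1ℤ) ℤ.+ x ℤ.* (y ℤ.- 1ℤ)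
      expand = ℤ-Solver.solve-∀
      split : + (c ℕ.^ (l ℕ.+ m)) ℤ.- 1ℤ
        ≡ (+ (c ℕ.^ l) ℤ.- 1ℤ) ℤ.+ + (c ℕ.^ l) ℤ.* (+ (c ℕ.^ m) ℤ.- 1ℤ)
      split = trans
        (cong (ℤ._- 1ℤ) (trans (cong +_ (ℕᵖ.^-distribˡ-+-* c l m)) (ℤᵖ.pos-* (c ℕ.^ l) (c ℕ.^ m))))
        (expand (+ (c ℕ.^ l)) (+ (c ℕ.^ m)))

    open IsΔ isΔ

    p∤Δ : ¬ + p ∣ + Δ
    p∤Δ = go Δ refl
      where
      go : ∀ k → k ≡ Δ → ¬ + p ∣ + k
      go zero    refl _ = contradiction refl Δ≢0
      go (suc k) refl   = p∤suc Δ<p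

    -- The difference of the two moments is p (X - Y) with X = c^N (c^(l+m) - 1) Δ. In Y one term
    -- contains Δ - δ / p, divisible by p by the choice of Δ. The other comes from replacing c^(l+m)
    -- by c^l, which differ by a multiple of p, and contains `B̂ l`, again divisible by p. So p²
    -- would force p ∣ X, a product of factors prime to p.
    p²∤moment : ∀ N ws → suc (e ℕ.+ m) < N →
      (∀ k → k < N → pow c N * G c k ≡ fromℤ (moment ws k)) →
      ¬ (+ p) ℤ.^ 2 ∣ moment ws (e ℕ.+ m ℕ.* 1) ℤ.- moment ws (e ℕ.+ m ℕ.* 0)
    p²∤moment N ws N-large G≡ p²∣ = ∤-* p-prime (∤-* p-prime (p∤c^ N) p∤c^[l+m]-1) p∤Δ
      (∣ₚ₁-fromℤ (α ℤ.* γ ℤ.* + Δ) (subst (1 ∣ₚ_) (add-back X Y) (∣ₚ-+ 1∣ₚX-Y 1∣ₚY)))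
      where
      open ≡-Reasoning
      α  = + (c ℕ.^ N)
      γ  = + (c ℕ.^ (l ℕ.+ m)) ℤ.- 1ℤ
      δ  = B̂ (l ℕ.+ p ∸ 1) - B̂ l
      r  = fromℕ Δ - recip p * δ
      a  = quotient p∣c^m-1
      X  = fromℤ (α ℤ.* γ ℤ.* + Δ)
      Y  = fromℤ (α ℤ.* γ) * r - fromℤ (α ℤ.* + (c ℕ.^ l) ℤ.* a) * B̂ l

      add-back : ∀ x y → (x - y) + y ≡ x
      add-back = solve-∀ ℚ-ring

      1∣ₚY : 1 ∣ₚ Y
      1∣ₚY = ∣ₚ-- (∣ₚ-* (α ℤ.* γ) (∣ℚ⇒∣ₚ {0} r (subst (_∣ℚ r) (sym (ℕᵖ.*-identityʳ p)) Δ≡)))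
                  (∣ₚ-* (α ℤ.* + (c ℕ.^ l) ℤ.* a) 1∣ₚB̂l)

      c^[l+m]-c^l : + (c ℕ.^ (l ℕ.+ m)) ≡ + (c ℕ.^ l) ℤ.+ + (c ℕ.^ l) ℤ.* a ℤ.* + p
      c^[l+m]-c^l = begin
        + (c ℕ.^ (l ℕ.+ m))                                     ≡⟨ cong +_ (ℕᵖ.^-distribˡ-+-* c l m) ⟩
        + (c ℕ.^ l ℕ.* c ℕ.^ m)                                 ≡⟨ ℤᵖ.pos-* (c ℕ.^ l) (c ℕ.^ m) ⟩
        + (c ℕ.^ l) ℤ.* + (c ℕ.^ m)                             ≡⟨ expand (+ (c ℕ.^ l)) (+ (c ℕ.^ m)) ⟩
        + (c ℕ.^ l) ℤ.+ + (c ℕ.^ l) ℤ.* (+ (c ℕ.^ m) ℤ.- 1ℤ)    ≡⟨ cong (λ x → + (c ℕ.^ l) ℤ.+ + (c ℕ.^ l) ℤ.* x) (_∣_.equality p∣c^m-1) ⟩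
        + (c ℕ.^ l) ℤ.+ + (c ℕ.^ l) ℤ.* (a ℤ.* + p)             ≡⟨ cong (ℤ._+_ (+ (c ℕ.^ l))) (ℤᵖ.*-assoc (+ (c ℕ.^ l)) a (+ p)) ⟨
        + (c ℕ.^ l) ℤ.+ + (c ℕ.^ l) ℤ.* a ℤ.* + p               ∎
        where
        expand : ∀ x y → x ℤ.* y ≡ x ℤ.+ x ℤ.* (y ℤ.- 1ℤ)
        expand = ℤ-Solver.solve-∀

      γ≡ : γ ≡ (+ (c ℕ.^ l) ℤ.- 1ℤ) ℤ.+ + (c ℕ.^ l) ℤ.* a ℤ.* + p
      γ≡ = trans (cong (ℤ._- 1ℤ) c^[l+m]-c^l) (swap (+ (c ℕ.^ l)) (+ (c ℕ.^ l) ℤ.* a ℤ.* + p))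
        where
        swap : ∀ x y → (x ℤ.+ y) ℤ.- 1ℤ ≡ (x ℤ.- 1ℤ) ℤ.+ y
        swap = ℤ-Solver.solve-∀

      δ≡ : fromℕ p * (recip p * δ) ≡ δ
      δ≡ = trans (sym (ℚᵖ.*-assoc (fromℕ p) (recip p) δ))
        (trans (cong (_* δ) (recip-inverseʳ m)) (ℚᵖ.*-identityˡ δ))

      E1 : e ℕ.+ m ℕ.* 1 ≡ e ℕ.+ m
      E1 = cong (e ℕ.+_) (ℕᵖ.*-identityʳ m)

      E0 : e ℕ.+ m ℕ.* 0 ≡ e
      E0 = trans (cong (e ℕ.+_) (ℕᵖ.*-zeroʳ m)) (ℕᵖ.+-identityʳ e)

      moment₁ : fromℤ (moment ws (e ℕ.+ m ℕ.* 1)) ≡ fromℤ α * (fromℤ γ * B̂ (l ℕ.+ p ∸ 1))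
      moment₁ = begin
        fromℤ (moment ws (e ℕ.+ m ℕ.* 1))
          ≡⟨ cong (fromℤ ∘ moment ws) E1 ⟩
        fromℤ (moment ws (e ℕ.+ m))
          ≡⟨ G≡ (e ℕ.+ m) (ℕᵖ.<-trans (ℕᵖ.n<1+n _) N-large) ⟨
        fromℤ α * ((pow c (l ℕ.+ m) - 1ℚ) * B̂ (l ℕ.+ m))
          ≡⟨ cong₂ (λ x k → fromℤ α * (x * B̂ k)) (sym (fromℤ-- (+ (c ℕ.^ (l ℕ.+ m))) 1ℤ)) (sym (ℕᵖ.+-suc e m)) ⟩
        fromℤ α * (fromℤ γ * B̂ (l ℕ.+ p ∸ 1)) ∎

      moment₀ : fromℤ (moment ws (e ℕ.+ m ℕ.* 0)) ≡ fromℤ α * (fromℤ (+ (c ℕ.^ l) ℤ.- 1ℤ) * B̂ l)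
      moment₀ = begin
        fromℤ (moment ws (e ℕ.+ m ℕ.* 0))
          ≡⟨ cong (fromℤ ∘ moment ws) E0 ⟩
        fromℤ (moment ws e)
          ≡⟨ G≡ e (ℕᵖ.<-trans (s≤s (ℕᵖ.m≤m+n e m)) N-large) ⟨
        fromℤ α * ((pow c l - 1ℚ) * B̂ l)
          ≡⟨ cong (λ x → fromℤ α * (x * B̂ l)) (fromℤ-- (+ (c ℕ.^ l)) 1ℤ) ⟨
        fromℤ α * (fromℤ (+ (c ℕ.^ l) ℤ.- 1ℤ) * B̂ l) ∎

      difference : fromℤ (moment ws (e ℕ.+ m ℕ.* 1) ℤ.- moment ws (e ℕ.+ m ℕ.* 0)) ≡ fromℕ p * (X - Y)
      difference = begin
        fromℤ (moment ws (e ℕ.+ m ℕ.* 1) ℤ.- moment ws (e ℕ.+ m ℕ.* 0))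
          ≡⟨ trans (fromℤ-- (moment ws (e ℕ.+ m ℕ.* 1)) (moment ws (e ℕ.+ m ℕ.* 0))) (cong₂ _-_ moment₁ moment₀) ⟩
        fromℤ α * (fromℤ γ * b₁) - fromℤ α * (g₀ * B̂ l)
          ≡⟨ regroup (fromℤ α) (fromℤ γ) b₁ g₀ (B̂ l) ⟩
        fromℤ α * (fromℤ γ * δ + (fromℤ γ - g₀) * B̂ l)
          ≡⟨ cong₂ (λ x y → fromℤ α * (fromℤ γ * x + (y - g₀) * B̂ l)) (sym δ≡) fromℤ-γ ⟩
        fromℤ α * (fromℤ γ * (fromℕ p * (recip p * δ)) + ((g₀ + h * fromℕ p) - g₀) * B̂ l)
          ≡⟨ collect (fromℤ α) (fromℤ γ) (fromℕ p) (recip p * δ) g₀ h (B̂ l) (fromℕ Δ) ⟩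
        fromℕ p * (fromℤ α * fromℤ γ * fromℕ Δ - (fromℤ α * fromℤ γ * r - fromℤ α * h * B̂ l))
          ≡⟨ cong₂ (λ x y → fromℕ p * (x * fromℕ Δ - (x * r - y * B̂ l))) (sym (fromℤ-* α γ)) α*h ⟩
        fromℕ p * (fromℤ (α ℤ.* γ) * fromℕ Δ - Y)
          ≡⟨ cong (λ x → fromℕ p * (x - Y)) (fromℤ-* (α ℤ.* γ) (+ Δ)) ⟨
        fromℕ p * (X - Y) ∎
        where
        b₁ = B̂ (l ℕ.+ p ∸ 1)
        g₀ = fromℤ (+ (c ℕ.^ l) ℤ.- 1ℤ)
        h  = fromℤ (+ (c ℕ.^ l) ℤ.* a)
        fromℤ-γ : fromℤ γ ≡ g₀ + h * fromℕ p
        fromℤ-γ = trans (cong fromℤ γ≡)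
          (trans (fromℤ-+ (+ (c ℕ.^ l) ℤ.- 1ℤ) (+ (c ℕ.^ l) ℤ.* a ℤ.* + p))
                 (cong (_+_ g₀) (fromℤ-* (+ (c ℕ.^ l) ℤ.* a) (+ p))))
        α*h : fromℤ α * h ≡ fromℤ (α ℤ.* + (c ℕ.^ l) ℤ.* a)
        α*h = trans (sym (fromℤ-* α (+ (c ℕ.^ l) ℤ.* a))) (cong fromℤ (sym (ℤᵖ.*-assoc α (+ (c ℕ.^ l)) a)))
        regroup : ∀ α γ b₁ g₀ b → α * (γ * b₁) - α * (g₀ * b) ≡ α * (γ * (b₁ - b) + (γ - g₀) * b)
        regroup = solve-∀ ℚ-ring
        collect : ∀ α γ p x g₀ h b Δ → α * (γ * (p * x) + ((g₀ + h * p) - g₀) * b)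
          ≡ p * (α * γ * Δ - (α * γ * (Δ - x) - α * h * b))
        collect = solve-∀ ℚ-ring

      1∣ₚX-Y : 1 ∣ₚ X - Y
      1∣ₚX-Y = ∣ₚ-p*-cancel (subst (2 ∣ₚ_) difference (fromℤ-∣ₚ {2} (moment ws (e ℕ.+ m ℕ.* 1) ℤ.- moment ws (e ℕ.+ m ℕ.* 0)) p²∣))

    B̂-separates-+ : ∀ n t d → n ≤ t →
      suc n ∣ₚ B̂ (l ℕ.+ m ℕ.* (t ℕ.+ d)) → suc n ∣ₚ B̂ (l ℕ.+ m ℕ.* t) → p ℕ.^ n ℕ∣.∣ d
    B̂-separates-+ n t d n≤t div₁ div₀ = separate (G-moment c N)
      where
      -- Large enough for the indices at `t + d` and `t` as well as for `E 1` = e + m, which carries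
      -- Δ.
      N = suc (suc ((e ℕ.+ m) ℕ.+ (e ℕ.+ m ℕ.* (t ℕ.+ d))))
      separate : ∃[ ws ] (∀ k → k < N → pow c N * G c k ≡ fromℤ (moment ws k)) → p ℕ.^ n ℕ∣.∣ d
      separate (ws , G≡) = moment-separates p-prime odd m e 2≤e fermat ws
        (p²∤moment N ws (s≤s (s≤s (ℕᵖ.m≤m+n (e ℕ.+ m) _))) G≡) n t d n≤t
        (∣m∣n⇒∣m-n (∣moment (t ℕ.+ d) ℕᵖ.≤-refl div₁) (∣moment t (ℕᵖ.m≤m+n t d) div₀)) n ℕᵖ.≤-refl
        where
        ∣moment : ∀ s → s ≤ t ℕ.+ d → suc n ∣ₚ B̂ (l ℕ.+ m ℕ.* s) → (+ p) ℤ.^ suc n ∣ moment ws (e ℕ.+ m ℕ.* s)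
        ∣moment s s≤ div = ∣ₚ-fromℤ (moment ws (e ℕ.+ m ℕ.* s)) (subst (suc n ∣ₚ_)
          (trans (cong (λ x → pow c N * (x * B̂ (l ℕ.+ m ℕ.* s))) (fromℤ-- (+ (c ℕ.^ (l ℕ.+ m ℕ.* s))) 1ℤ))
                 (G≡ (e ℕ.+ m ℕ.* s) (s≤s (ℕᵖ.m≤n⇒m≤1+n (ℕᵖ.≤-trans (ℕᵖ.+-monoʳ-≤ e (ℕᵖ.*-monoʳ-≤ m s≤)) (ℕᵖ.m≤n+m _ (e ℕ.+ m)))))))
          (∣ₚ-* (+ (c ℕ.^ N)) (∣ₚ-* (+ (c ℕ.^ (l ℕ.+ m ℕ.* s)) ℤ.- 1ℤ) div)))

  module _ {Δ : ℕ} (isΔ : IsΔ p l Δ) (Δ≢0 : Δ ≢ 0) where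

    B̂-separates : ∀ n s t → n ≤ s → n ≤ t →
      suc n ∣ₚ B̂ (l ℕ.+ m ℕ.* s) → suc n ∣ₚ B̂ (l ℕ.+ m ℕ.* t) → + (p ℕ.^ n) ∣ + s ℤ.- + t
    B̂-separates n s t n≤s n≤t div-s div-t = separate (nontrivial-power e l<m) (ℕᵖ.≤-total t s)
      where
      ordered : ∀ {i j} → j ≤ i → p ℕ.^ n ℕ∣.∣ i ∸ j → + (p ℕ.^ n) ∣ + i ℤ.- + j
      ordered {i} {j} j≤i p^n∣ = subst (+ (p ℕ.^ n) ∣_)
        (sym (trans (ℤᵖ.[+m]-[+n]≡m⊖n i j) (ℤᵖ.⊖-≥ j≤i))) (∣ᵤ⇒∣ p^n∣)
      separate : ∃[ c ] (¬ + p ∣ + c) × (¬ + p ∣ + (c ℕ.^ l) ℤ.- 1ℤ) → t ≤ s ⊎ s ≤ t →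
        + (p ℕ.^ n) ∣ + s ℤ.- + t
      separate (c , p∤c , p∤c^l-1) (inj₁ t≤s) = ordered t≤s
        (B̂-separates-+ isΔ Δ≢0 c p∤c p∤c^l-1 n t (s ∸ t) n≤t
          (subst (λ x → suc n ∣ₚ B̂ (l ℕ.+ m ℕ.* x)) (sym (ℕᵖ.m+[n∸m]≡n t≤s)) div-s) div-t)
      separate (c , p∤c , p∤c^l-1) (inj₂ s≤t) = subst (+ (p ℕ.^ n) ∣_) (negate (+ t) (+ s))
        (∣m⇒∣-m (ordered s≤t (B̂-separates-+ isΔ Δ≢0 c p∤c p∤c^l-1 n s (t ∸ s) n≤s
          (subst (λ x → suc n ∣ₚ B̂ (l ℕ.+ m ℕ.* x)) (sym (ℕᵖ.m+[n∸m]≡n s≤t)) div-t) div-s)))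
        where
        negate : ∀ a b → ℤ.- (a ℤ.- b) ≡ b ℤ.- a
        negate = ℤ-Solver.solve-∀

-- Zeros of the p-adic zeta function

module _ {m e : ℕ} (irregular : (suc m , suc e) ∈ Ψ-irr 1) where

  open IrregularPair irregular renaming (prime to p-prime)
  open Local p-prime
  open Zeta irregular

  ζₚ≡ : ∀ k → ζ[ p ][1- k ] ≡ fromℤ (+ (p ℕ.^ (k ∸ 1)) ℤ.- 1ℤ) * B̂ k
  ζₚ≡ k = trans (negate (pow p (k ∸ 1)) (B̂ k)) (cong (_* B̂ k) (sym (fromℤ-- (+ (p ℕ.^ (k ∸ 1))) 1ℤ)))
    where
    negate : ∀ x b → (1ℚ - x) * - b ≡ (x - 1ℚ) * b
    negate = solve-∀ ℚ-ring

  ζₚ-∣ₚ : ∀ {n} k → n ∣ₚ B̂ k → n ∣ₚ ζ[ p ][1- k ]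
  ζₚ-∣ₚ {n} k n∣B̂ = subst (n ∣ₚ_) (sym (ζₚ≡ k)) (∣ₚ-* (+ (p ℕ.^ (k ∸ 1)) ℤ.- 1ℤ) n∣B̂)

  -- The index is at least 2, so the Euler factor is -1 modulo p up to sign, a p-adic unit.
  ∣ₚ-ζₚ : ∀ {n} k → n ∣ₚ ζ[ p ][1- suc (suc k) ] → n ∣ₚ B̂ (suc (suc k))
  ∣ₚ-ζₚ {n} k n∣ζ = ∣ₚ-*-cancel (+ (p ℕ.^ suc k) ℤ.- 1ℤ) p∤p^k-1
    (subst (n ∣ₚ_) (ζₚ≡ (suc (suc k))) n∣ζ)
    where
    p∣p^k : + p ∣ + (p ℕ.^ suc k)
    p∣p^k = ∣ᵤ⇒∣ (ℕ∣.m∣m*n (p ℕ.^ k))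
    p∤p^k-1 : ¬ + p ∣ + (p ℕ.^ suc k) ℤ.- 1ℤ
    p∤p^k-1 p∣ = p∤1 (∣-cancel p∣p^k p∣)

  ∣-∣ₚ : ∀ {n} z → + (p ℕ.^ n) ∣ z → n ∣ₚ fromℤ z
  ∣-∣ₚ {n} z p^n∣z = fromℤ-∣ₚ z (subst (_∣ z) (pos-^ p n) p^n∣z)

  _Approximates_ : (ℕ → ℕ) → ℤₚ p → Set
  t Approximates s = ∀ ν → + (p ℕ.^ ν) ∣ + t ν ℤ.- approx s ν

  approximates-≤ : ∀ t s → t Approximates s → ∀ {n ν} → n ≤ ν → + (p ℕ.^ n) ∣ + t ν ℤ.- approx s n
  approximates-≤ t s t≈s {n} {ν} n≤ν = subst (+ (p ℕ.^ n) ∣_)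
    (telescope (+ t ν) (approx s ν) (approx s n))
    (∣m∣n⇒∣m+n (∣-trans (∣ᵤ⇒∣ (^-monoʳ-∣ p n≤ν)) (t≈s ν)) (approx-coherent-≤ s n≤ν))
    where
    telescope : ∀ a b c → (a ℤ.- b) ℤ.+ (b ℤ.- c) ≡ a ℤ.- c
    telescope = ℤ-Solver.solve-∀

  approximates⇒⟶ : ∀ t s → t Approximates s → (fromℕ ∘ t) ⟶ s
  approximates⇒⟶ t s t≈s n = n , λ ν n≤ν → ∣ₚ⇒∣ℚ (subst (n ∣ₚ_) (fromℤ-- (+ t ν) (approx s n))
    (∣-∣ₚ (+ t ν ℤ.- approx s n) (approximates-≤ t s t≈s n≤ν)))

  -- The summand ν * p ^ ν makes the sequence grow.
  residues : ℤₚ p → ℕ → ℕ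
  residues s ν = (approx s ν ℤ/.%ℕ (p ℕ.^ ν)) {{ℕᵖ.m^n≢0 p ν}} ℕ.+ ν ℕ.* p ℕ.^ ν

  residues-approximates : ∀ s → residues s Approximates s
  residues-approximates s ν = divides (+ ν ℤ.- q) (begin
    + (r ℕ.+ ν ℕ.* P) ℤ.- approx s ν
      ≡⟨ cong₂ (λ x y → + r ℤ.+ x ℤ.- y) (ℤᵖ.pos-* ν P) (ℤ/.a≡a%ℕn+[a/ℕn]*n (approx s ν) P) ⟩
    + r ℤ.+ + ν ℤ.* + P ℤ.- (+ r ℤ.+ q ℤ.* + P)
      ≡⟨ cancel (+ r) (+ ν) (+ P) q ⟩
    (+ ν ℤ.- q) ℤ.* + P ∎)
    where
    open ≡-Reasoning
    instance _ = ℕᵖ.m^n≢0 p ν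
    P = p ℕ.^ ν
    r = approx s ν ℤ/.%ℕ P
    q = approx s ν ℤ/./ℕ P
    cancel : ∀ r ν P q → r ℤ.+ ν ℤ.* P ℤ.- (r ℤ.+ q ℤ.* P) ≡ (ν ℤ.- q) ℤ.* P
    cancel = ℤ-Solver.solve-∀

  ≤-residues : ∀ s ν → ν ≤ residues s ν
  ≤-residues s ν = ℕᵖ.≤-trans (ℕᵖ.m≤m*n ν (p ℕ.^ ν) {{ℕᵖ.m^n≢0 p ν}}) (ℕᵖ.m≤n+m (ν ℕ.* p ℕ.^ ν) _)

  module _ {Δ : ℕ} (isΔ : IsΔ p l Δ) (Δ≢0 : Δ ≢ 0)
           (ζ : ℤₚ p → ℤₚ p) (isζ : IsPadicZeta p l ζ) where

    -- The interpolation property along `residues s` at precision n + 1, one more than wanted since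
    -- `B̂-separates` loses a factor p.
    zero⇒B̂ : ∀ s → ζ s ≈ 0ₚ → ∀ n →
      ∃[ N ] ∀ ν → N ≤ ν → suc n ∣ₚ B̂ (l ℕ.+ m ℕ.* residues s ν)
    zero⇒B̂ s ζs≈0 n = N , λ ν N≤ν →
      cancel-factor (l ℕ.+ m ℕ.* residues s ν) (ℕᵖ.≤-trans 2≤l (ℕᵖ.m≤m+n l _))
        (subst (suc n ∣ₚ_) (add-back ζ[ p ][1- l ℕ.+ m ℕ.* residues s ν ] (fromℤ (approx (ζ s) (suc n))))
          (∣ₚ-+ (∣ℚ⇒∣ₚ (ζ[ p ][1- l ℕ.+ m ℕ.* residues s ν ] - fromℤ (approx (ζ s) (suc n))) (close ν N≤ν)) small))
      where
      limit = isζ s (residues s) (approximates⇒⟶ (residues s) s (residues-approximates s)) (suc n)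
      N     = proj₁ limit
      close = proj₂ limit
      small : suc n ∣ₚ fromℤ (approx (ζ s) (suc n))
      small = ∣-∣ₚ (approx (ζ s) (suc n))
        (subst (+ (p ℕ.^ suc n) ∣_) (ℤᵖ.+-identityʳ (approx (ζ s) (suc n))) (∣ᵤ⇒∣ (ζs≈0 (suc n))))
      add-back : ∀ x y → (x - y) + y ≡ x
      add-back = solve-∀ ℚ-ring
      cancel-factor : ∀ k → 2 ≤ k → suc n ∣ₚ ζ[ p ][1- k ] → suc n ∣ₚ B̂ k
      cancel-factor (suc zero)    (s≤s ())
      cancel-factor (suc (suc k)) _ = ∣ₚ-ζₚ k

    zeros-agree : ∀ s s′ → ζ s ≈ 0ₚ → ζ s′ ≈ 0ₚ → s ≈ s′
    zeros-agree s s′ ζs≈0 ζs′≈0 n = ∣⇒∣ᵤ (subst (+ (p ℕ.^ n) ∣_)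
      (telescope (approx s n) (+ t) (+ t′) (approx s′ n))
      (∣m∣n⇒∣m+n
        (∣m∣n⇒∣m-n
          (B̂-separates isΔ Δ≢0 n t t′ (ℕᵖ.≤-trans n≤ν (≤-residues s ν)) (ℕᵖ.≤-trans n≤ν (≤-residues s′ ν))
            (proj₂ (zero⇒B̂ s ζs≈0 n) ν N≤ν) (proj₂ (zero⇒B̂ s′ ζs′≈0 n) ν N′≤ν))
          (approximates-≤ (residues s) s (residues-approximates s) n≤ν))
        (approximates-≤ (residues s′) s′ (residues-approximates s′) n≤ν)))
      where
      N  = proj₁ (zero⇒B̂ s ζs≈0 n)
      N′ = proj₁ (zero⇒B̂ s′ ζs′≈0 n)
      -- Beyond both thresholds and n; as residues are at least ν, the bounds n ≤ t and n ≤ t′ hold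
      -- as well.
      ν  = N ℕ.+ N′ ℕ.+ n
      t  = residues s ν
      t′ = residues s′ ν
      n≤ν : n ≤ ν
      n≤ν = ℕᵖ.m≤n+m n (N ℕ.+ N′)
      N≤ν : N ≤ ν
      N≤ν = ℕᵖ.≤-trans (ℕᵖ.m≤m+n N N′) (ℕᵖ.m≤m+n (N ℕ.+ N′) n)
      N′≤ν : N′ ≤ ν
      N′≤ν = ℕᵖ.≤-trans (ℕᵖ.m≤n+m N′ N) (ℕᵖ.m≤m+n (N ℕ.+ N′) n)
      telescope : ∀ a t t′ b → ((t ℤ.- t′) ℤ.- (t ℤ.- a)) ℤ.+ (t′ ℤ.- b) ≡ a ℤ.- b
      telescope = ℤ-Solver.solve-∀

    χ-zero : (L : Lift p l) → ζ (χ L) ≈ 0ₚ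
    χ-zero L zero    = ℕ∣.1∣ _
    χ-zero L (suc n) = ∣⇒∣ᵤ (subst₂ _∣_ (sym (pos-^ p (suc n))) (sym (ℤᵖ.+-identityʳ a))
      (∣ₚ-fromℤ a (subst (suc n ∣ₚ_) (cancel ζ[ p ][1- l ℕ.+ m ℕ.* t ν ] (fromℤ a))
        (∣ₚ-- (ζₚ-∣ₚ (l ℕ.+ m ℕ.* t ν) p^n∣B̂[l+mt])
              (∣ℚ⇒∣ₚ (ζ[ p ][1- l ℕ.+ m ℕ.* t ν ] - fromℤ a) (proj₂ limit ν (ℕᵖ.m≤m+n (proj₁ limit) n)))))))
      where
      open Lift L
      t : ℕ → ℕ
      t ν = ∑[ (λ ν → s (ν ℕ.+ 2) ℕ.* p ℕ.^ ν) , ν ]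
      a = approx (ζ (χ L)) (suc n)
      limit = isζ (χ L) t
        (approximates⇒⟶ t (χ L) (λ ν → divides 0ℤ (ℤᵖ.+-inverseʳ (+ t ν)))) (suc n)
      ν = proj₁ limit ℕ.+ n
      -- The partial sum with ν digits belongs to the pair of order ν + 1, so l + m * t ν is exactly
      -- `l-of (suc ν)` and p^(ν+1) divides its `B̂`.
      p^n∣B̂[l+mt] : suc n ∣ₚ B̂ (l ℕ.+ m ℕ.* t ν)
      p^n∣B̂[l+mt] = subst (λ k → suc n ∣ₚ B̂ k) (digits (suc ν) (s≤s z≤n))
        (∣ℚ⇒∣ₚ (B̂ (l-of (suc ν))) (ℕ∣.∣-trans (^-monoʳ-∣ p (s≤s (ℕᵖ.m≤n+m n (proj₁ limit))))
          (IrregularPair.p^n∣B̂ (l-of∈Ψ (suc ν) (s≤s z≤n)))))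
      cancel : ∀ x y → x - (x - y) ≡ y
      cancel = solve-∀ ℚ-ring

theorem4p6 : (p l : ℕ) → (p , l) ∈ Ψ-irr 1 →
    (Δ : ℕ) → IsΔ p l Δ → Δ ≢ 0 →
    (L : Lift p l) →
    (ζ : ℤₚ p → ℤₚ p) → IsPadicZeta p l ζ →
    (ζ (χ L) ≈ 0ₚ) × (∀ s → ζ s ≈ 0ₚ → s ≈ χ L)
theorem4p6 zero    l       irregular = contradiction (IrregularPair.prime irregular) λ ()
theorem4p6 (suc m) zero    irregular = contradiction (IrregularPair.2≤l irregular) λ ()
theorem4p6 (suc m) (suc e) irregular Δ isΔ Δ≢0 L ζ isζ =
  χ-zero irregular isΔ Δ≢0 ζ isζ L ,
  λ s ζs≈0 → zeros-agree irregular isΔ Δ≢0 ζ isζ s (χ L) ζs≈0 (χ-zero irregular isΔ Δ≢0 ζ isζ L)
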